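{- For integers $\nu\ge1$ and $n>\nu(3\nu+5)/2$, \[ (-1)^\nu\left(\sum_{\tau=0}^{\nu}(-1)^\tau p\!\left(n-\tfrac{\tau(3\tau+1)}{2}\right)-\sum_{\tau=0}^{\nu-1}(-1)^\tau p\!\left(n-\tfrac{\tau(3\tau+5)}{2}-1\right)\right)=p(2,3,\nu;n)+p(1,3,\nu;n). \]
   Context: $p(n)$ is the number of partitions of $n$. Definition of $M(a,m,\nu;n)$ (integers $\nu\ge0$, $1\le a<m$, $n\ge0$): for a partition $\lambda_1\ge\dots\ge\lambda_k$ of $n$ into parts $\equiv a\pmod m$, put $\ell_i=(\lambda_i-a)/m+1$ (the number of boxes of the row of $\lambda_i$ in the $m$-modular Young diagram), and let $t$ be the largest integer $0\le t\le k$ with $\ell_t\ge t+\nu+2$ (height of the $(\nu+2)$-Durfee rectangle, whose width is $t+\nu+2$). $M(a,m,\nu;n)$ counts partitions of $n$ into parts $\equiv a\pmod m$ in which each of $a,a+m,\dots,a+m\nu$ occurs at least once and $\ell_i<t+\nu+2$ for all $i>t$. Definition: $p(a,m,\nu;n)$ is the number of partitions of $n$ such that, if $\beta$ denotes the sum of the parts $\not\equiv a\pmod m$, the parts $\equiv a\pmod m$ form a partition of $n-\beta$ counted by $M(a,m,\nu;n-\beta)$. -}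

module Defs where

open import Data.Nat using (ℕ; zero; suc; _+_; _*_; _∸_; _≤_; _<_; _≥_; _≟_; _≤?_; _<?_; _≥?_; NonZero)
open import Data.Nat.DivMod using (_/_; _%_)
open import Data.List using (List; []; _∷_; [_]; map; concatMap; upTo; length; filter; drop)
open import Data.Nat.ListAction using (sum)
open import Data.List.Relation.Unary.All using (All; all?)
open import Data.List.Relation.Unary.Linked using (Linked; linked?)
open import Data.List.Membership.DecPropositional _≟_ using (_∈_; _∈?_)
open import Data.Product using (_×_)
open import Data.Unit using (⊤)
open import Relation.Nullary using (Dec; yes; no; ¬?)
open import Relation.Nullary.Decidable using (_×-dec_)
open import Relation.Binary.PropositionalEquality using (_≡_)
open import Data.Integer as ℤ using (ℤ)

IsPartition : ℕ → List ℕ → Set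
IsPartition n xs = Linked _≥_ xs × All (0 <_) xs × sum xs ≡ n

isPartition? : (n : ℕ) → (xs : List ℕ) → Dec (IsPartition n xs)
isPartition? n xs = linked? _≥?_ xs ×-dec all? (0 <?_) xs ×-dec (sum xs ≟ n)

listsOfLen : ℕ → ℕ → List (List ℕ)
listsOfLen n zero    = [ [] ]
listsOfLen n (suc k) = concatMap (λ x → map (x ∷_) (listsOfLen n k)) (map suc (upTo n))

-- all lists of length ≤ n with entries in {1,…,n}; every partition of n
-- occurs exactly once in this list.
candidates : ℕ → List (List ℕ)
candidates n = concatMap (listsOfLen n) (upTo (suc n))

#partitionsWith : (n : ℕ) (Q : List ℕ → Set) → (∀ xs → Dec (Q xs)) → ℕ
#partitionsWith n Q Q? = length (filter (λ xs → isPartition? n xs ×-dec Q? xs) (candidates n))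

p : ℕ → ℕ
p n = #partitionsWith n (λ _ → ⊤) (λ _ → yes Data.Unit.tt)

-- 0-indexed lookup with default 0 (ℓᵢ = at ℓs (i ∸ 1) for 1 ≤ i ≤ k)
at : List ℕ → ℕ → ℕ
at []       _       = 0
at (x ∷ xs) zero    = x
at (x ∷ xs) (suc i) = at xs i

-- ℓᵢ = (λᵢ - a)/m + 1 : number of boxes of the row of λᵢ in the m-modular diagram
rowLengths : (a m : ℕ) .{{_ : NonZero m}} → List ℕ → List ℕ
rowLengths a m xs = map (λ x → (x ∸ a) / m + 1) xs

durfeeAux : List ℕ → ℕ → ℕ → ℕ
durfeeAux ls c zero = 0
durfeeAux ls c (suc j) with suc j + c ≤? at ls j
... | yes _ = suc j
... | no  _ = durfeeAux ls c j

-- height t of the (ν+2)-Durfee rectangle: largest 0 ≤ t ≤ k with ℓₜ ≥ t + ν + 2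
durfeeHeight : (ν : ℕ) → List ℕ → ℕ
durfeeHeight ν ls = durfeeAux ls (ν + 2) (length ls)

MCond : (a m ν : ℕ) .{{_ : NonZero m}} → List ℕ → Set
MCond a m ν xs =
  All (λ j → (a + m * j) ∈ xs) (upTo (suc ν)) ×
  All (_< durfeeHeight ν ls + ν + 2) (drop (durfeeHeight ν ls) ls)
  where ls = rowLengths a m xs

MCond? : (a m ν : ℕ) .{{_ : NonZero m}} → (xs : List ℕ) → Dec (MCond a m ν xs)
MCond? a m ν xs =
  all? (λ j → (a + m * j) ∈? xs) (upTo (suc ν)) ×-dec
  all? (_<? durfeeHeight ν ls + ν + 2) (drop (durfeeHeight ν ls) ls)
  where ls = rowLengths a m xs

_≡[_]_ : ℕ → (m : ℕ) .{{_ : NonZero m}} → ℕ → Set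
x ≡[ m ] a = x % m ≡ a % m

-- parts-condition of M(a,m,ν;N) (the partition-of-N condition is added by the counting)
IsMPart : (a m ν : ℕ) .{{_ : NonZero m}} → List ℕ → Set
IsMPart a m ν xs = All (λ x → x ≡[ m ] a) xs × MCond a m ν xs

IsMPart? : (a m ν : ℕ) .{{_ : NonZero m}} → (xs : List ℕ) → Dec (IsMPart a m ν xs)
IsMPart? a m ν xs = all? (λ x → x % m ≟ a % m) xs ×-dec MCond? a m ν xs

M : (a m ν : ℕ) .{{_ : NonZero m}} → ℕ → ℕ
M a m ν N = #partitionsWith N (IsMPart a m ν) (IsMPart? a m ν)

CountedByM : (a m ν : ℕ) .{{_ : NonZero m}} → ℕ → List ℕ → Set
CountedByM a m ν N xs = IsPartition N xs × IsMPart a m ν xs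

CountedByM? : (a m ν : ℕ) .{{_ : NonZero m}} → (N : ℕ) → (xs : List ℕ) → Dec (CountedByM a m ν N xs)
CountedByM? a m ν N xs = isPartition? N xs ×-dec IsMPart? a m ν xs

partsCong : (a m : ℕ) .{{_ : NonZero m}} → List ℕ → List ℕ
partsCong a m xs = filter (λ x → x % m ≟ a % m) xs

partsNotCong : (a m : ℕ) .{{_ : NonZero m}} → List ℕ → List ℕ
partsNotCong a m xs = filter (λ x → ¬? (x % m ≟ a % m)) xs

PCond : (a m ν : ℕ) .{{_ : NonZero m}} → ℕ → List ℕ → Set
PCond a m ν n xs = CountedByM a m ν (n ∸ sum (partsNotCong a m xs)) (partsCong a m xs)

PCond? : (a m ν : ℕ) .{{_ : NonZero m}} → (n : ℕ) → (xs : List ℕ) → Dec (PCond a m ν n xs)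
PCond? a m ν n xs = CountedByM? a m ν (n ∸ sum (partsNotCong a m xs)) (partsCong a m xs)

pν : (a m ν : ℕ) .{{_ : NonZero m}} → ℕ → ℕ
pν a m ν n = #partitionsWith n (PCond a m ν n) (PCond? a m ν n)

sumTo : ℕ → (ℕ → ℤ) → ℤ
sumTo zero    f = f 0
sumTo (suc k) f = sumTo k f ℤ.+ f (suc k)

{-# OPTIONS --safe #-}
module Submission where

open import Defs
open import Data.Empty using (⊥-elim)
import Data.Integer.Tactic.RingSolver as ℤSolver
open import Data.List using (List; []; _∷_; _++_; [_]; map; concatMap; cartesianProductWith; drop; filter; length; merge; replicate; upTo)
open import Data.List.Membership.Propositional using (_∈_)
open import Data.List.Membership.Propositional.Properties using (∈-∃++; ∈-++⁻; ∈-++⁺ˡ; ∈-++⁺ʳ; ∈-filter⁺; ∈-filter⁻; ∈-map⁺; ∈-map⁻; ∈-upTo⁺; ∈-upTo⁻; ∈-concat⁺′; ∈-cartesianProductWith⁺; ∈-cartesianProductWith⁻)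
import Data.List.Properties as List
open import Data.List.Relation.Binary.Permutation.Propositional using (_↭_; prep; swap; ↭-refl; ↭-reflexive; ↭-sym; ↭-trans; ↭⇒↭ₛ)
open import Data.List.Relation.Binary.Permutation.Propositional.Properties using (∈-resp-↭; All-resp-↭; drop-∷; merge-↭; ↭-length; filter-↭; shift; ++-identityʳ)
open import Data.List.Relation.Binary.Pointwise using (Pointwise-≡⇒≡)
open import Data.List.Relation.Unary.All as All using (All; []; _∷_)
import Data.List.Relation.Unary.All.Properties as All
open import Data.List.Relation.Unary.AllPairs as AllPairs using ([]; _∷_)
import Data.List.Relation.Unary.AllPairs.Properties as AllPairs
open import Data.List.Relation.Unary.Any using (here; there)
open import Data.List.Relation.Unary.Linked as Linked using (Linked; []; [-]; _∷_; linked?)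
import Data.List.Relation.Unary.Linked.Properties as Linked
import Data.List.Relation.Unary.Sorted.TotalOrder.Properties as Sorted
open import Data.List.Relation.Unary.Unique.Propositional using (Unique)
import Data.List.Relation.Unary.Unique.Propositional.Properties as Unique
open import Data.Nat using (ℕ; zero; suc; pred; _+_; _*_; _∸_; _≤_; _<_; _≥_; z≤n; s≤s; z<s; s<s; _≟_; _≤?_; _<?_; _≥?_; NonZero)
open import Data.List.Membership.DecPropositional _≟_ using (_∈?_)
open import Data.Nat.DivMod using (_/_; _%_; m*n/n≡m; m≡m%n+[m/n]*n; m<n⇒m%n≡m; [m+kn]%n≡m%n; /-monoˡ-≤)
open import Data.Nat.ListAction using (sum)
open import Data.Nat.ListAction.Properties using (sum-↭; sum-++)
open import Data.Nat.Properties
open import Data.Nat.Tactic.RingSolver using (solve-∀)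
open import Data.Product using (_×_; _,_; proj₁; proj₂)
open import Data.Sum as Sum using (_⊎_; inj₁; inj₂; [_,_]′)
open import Data.Unit using (⊤; tt)
open import Function using (_∘_; id; flip)
open import Level using (0ℓ)
open import Relation.Binary.Bundles using (DecTotalOrder)
import Relation.Binary.Construct.Flip.EqAndOrd as Flip
open import Relation.Binary.Definitions using (tri<; tri≈; tri>)
open import Relation.Binary.PropositionalEquality using (_≡_; _≢_; refl; sym; trans; cong; cong₂; subst; module ≡-Reasoning)
open import Relation.Nullary using (Dec; yes; no; ¬_; ¬?)
open import Relation.Nullary.Decidable using (_×-dec_)
open import Relation.Unary using (Pred; Decidable; _⊆_; _∪_)

-- Write Q_ν for the partitions counted by p(a,m,ν;n) and i₀ ≥ i₁ ≥ … for the
-- indices (x − a)/m of the parts x ≡ a (mod m).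
--
-- (1) Among the partitions of n containing a, a+m, …, a+mν, those outside Q_ν
-- have i_t = t+ν+1, where t is the Durfee height.  Lengthening the first t rows
-- by one box each, deleting row i_t and inserting a row of index ν+1 maps them
-- bijectively to Q_{ν+1}.  Hence |Q_ν| + |Q_{ν+1}| = p(n − Σ_{j≤ν} (a+mj)), and
-- for m = 3, a = 1, 2 the arguments are the two families of pentagonal shifts.
--
-- (2) The bijection of Bressoud and Zeilberger for Euler's recurrence, which
-- sends λ with t parts to (t+3j−1, λ₁−1, …, λ_t−1), shows that the numbers
-- A_j = #{λ ⊢ n − j(3j+1)/2 : λ₁ ≤ t+3j} satisfy A_j + A_{j+1} = p(n − j(3j+1)/2).
--
-- So |Q_ν| equals A_{ν+1} for a = 2 and A_{−ν} for a = 1, both sides vanishing for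
-- large ν, and the alternating sum of the theorem telescopes to A_{−ν} + A_{ν+1}.

-- Counting by injections between duplicate-free lists

module _ {A B : Set} where

  -- The image of the first element is cut out of `ys`. The other images stay in the remainder: `g`
  -- would send a coinciding image back to two different elements of a duplicate-free list.
  leftInverse⇒length≤ : ∀ (f : A → B) (g : B → A) {xs : List A} {ys : List B} → Unique xs →
    (∀ {x} → x ∈ xs → f x ∈ ys) → (∀ {x} → x ∈ xs → g (f x) ≡ x) →
    length xs ≤ length ys
  leftInverse⇒length≤ f g [] into inv = z≤n
  leftInverse⇒length≤ f g {x ∷ xs} (x∉ ∷ uniq) into inv
    with ∈-∃++ (into (here refl))
  ... | ys , zs , refl = begin
    suc (length xs)            ≤⟨ s≤s (leftInverse⇒length≤ f g uniq into′ (inv ∘ there)) ⟩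
    suc (length (ys ++ zs))    ≡⟨ cong suc (List.length-++ ys) ⟩
    suc (length ys + length zs) ≡⟨ sym (+-suc (length ys) (length zs)) ⟩
    length ys + suc (length zs) ≡⟨ sym (List.length-++ ys) ⟩
    length (ys ++ f x ∷ zs)    ∎
    where
    open ≤-Reasoning
    into′ : ∀ {x′} → x′ ∈ xs → f x′ ∈ ys ++ zs
    into′ {x′} x′∈ with ∈-++⁻ ys (into (there x′∈))
    ... | inj₁ p = ∈-++⁺ˡ p
    ... | inj₂ (there p) = ∈-++⁺ʳ ys p
    ... | inj₂ (here eq) = ⊥-elim (All.lookup x∉ x′∈
            (trans (sym (inv (here refl))) (trans (cong g (sym eq)) (inv (there x′∈)))))

-- Uniqueness and completeness of the candidate lists

concatMap-map : ∀ {A B C : Set} (f : A → B → C) xs ys →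
  concatMap (λ x → map (f x) ys) xs ≡ cartesianProductWith f xs ys
concatMap-map f []       ys = refl
concatMap-map f (x ∷ xs) ys = cong (map (f x) ys ++_) (concatMap-map f xs ys)

listsOfLen-unique : ∀ n k → Unique (listsOfLen n k)
listsOfLen-unique n zero    = [] ∷ []
listsOfLen-unique n (suc k) =
  subst Unique (sym (concatMap-map _∷_ (map suc (upTo n)) (listsOfLen n k)))
    (Unique.cartesianProductWith⁺ _∷_ List.∷-injective
      (Unique.map⁺ suc-injective (Unique.upTo⁺ n)) (listsOfLen-unique n k))

listsOfLen-length : ∀ n k {xs} → xs ∈ listsOfLen n k → length xs ≡ k
listsOfLen-length n zero    (here refl) = refl
listsOfLen-length n (suc k) xs∈
  with ∈-cartesianProductWith⁻ _∷_ (map suc (upTo n)) (listsOfLen n k)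
         (subst (_ ∈_) (concatMap-map _∷_ (map suc (upTo n)) (listsOfLen n k)) xs∈)
... | _ , _ , _ , ys∈ , refl = cong suc (listsOfLen-length n k ys∈)

∈-listsOfLen : ∀ n {xs} → All (0 <_) xs → All (_≤ n) xs → xs ∈ listsOfLen n (length xs)
∈-listsOfLen n []       []       = here refl
∈-listsOfLen n {_ ∷ xs} (s≤s z≤n ∷ ps) (q ∷ qs) =
  subst (_ ∈_) (sym (concatMap-map _∷_ (map suc (upTo n)) (listsOfLen n (length xs))))
    (∈-cartesianProductWith⁺ _∷_ (∈-map⁺ suc (∈-upTo⁺ q)) (∈-listsOfLen n ps qs))

-- Blocks belonging to different list lengths are disjoint, so concatenating them creates no
-- repetition.
candidates-unique : ∀ n → Unique (candidates n)
candidates-unique n = Unique.concat⁺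
  (All.map⁺ (All.universal (listsOfLen-unique n) (upTo (suc n))))
  (AllPairs.map⁺ (AllPairs.map disjoint (Unique.upTo⁺ (suc n))))
  where
  disjoint : ∀ {i j} → i ≢ j → ∀ {xs} → ¬ (xs ∈ listsOfLen n i × xs ∈ listsOfLen n j)
  disjoint i≢j (p , q) =
    i≢j (trans (sym (listsOfLen-length n _ p)) (listsOfLen-length n _ q))

all≤sum : ∀ xs → All (_≤ sum xs) xs
all≤sum []       = []
all≤sum (x ∷ xs) = m≤m+n x _ ∷ All.map (λ p → ≤-trans p (m≤n+m _ x)) (all≤sum xs)

length≤sum : ∀ {xs} → All (0 <_) xs → length xs ≤ sum xs
length≤sum []       = z≤n
length≤sum (p ∷ ps) = +-mono-≤ p (length≤sum ps)

-- The sum bounds every entry and, by positivity, also the number of entries. An inequality instead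
-- of `sum xs ≡ n` lets partitions with positive deficiency be found too.
∈-candidates : ∀ {n xs} → All (0 <_) xs → sum xs ≤ n → xs ∈ candidates n
∈-candidates {n} {xs} pos sum≤n = ∈-concat⁺′
  (∈-listsOfLen n pos (All.map (λ p → ≤-trans p sum≤n) (all≤sum xs)))
  (∈-map⁺ (listsOfLen n) (∈-upTo⁺ (s≤s (≤-trans (length≤sum pos) sum≤n))))

-- Counts of partitions with a deficiency

-- e is the deficiency n − |λ|; keeping it as a parameter makes p(n − e) vanish
-- for e > n without truncated subtraction.
Partition : (n e : ℕ) → List ℕ → Set
Partition n e xs = Linked _≥_ xs × All (0 <_) xs × sum xs + e ≡ n

partition? : ∀ n e → Decidable (Partition n e)
partition? n e xs = linked? _≥?_ xs ×-dec All.all? (0 <?_) xs ×-dec (sum xs + e ≟ n)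

# : (n e : ℕ) {Q : Pred (List ℕ) 0ℓ} → Decidable Q → ℕ
# n e Q? = length (filter (λ xs → partition? n e xs ×-dec Q? xs) (candidates n))

module _ {n n′ : ℕ} {R R′ : Pred (List ℕ) 0ℓ} (R? : Decidable R) (R′? : Decidable R′)
  (R⊆ : R ⊆ (_∈ candidates n)) (R′⊆ : R′ ⊆ (_∈ candidates n′))
  (f g : List ℕ → List ℕ)
  (to : ∀ {xs} → R xs → R′ (f xs)) (from : ∀ {ys} → R′ ys → R (g ys))
  (g∘f : ∀ {xs} → R xs → g (f xs) ≡ xs) (f∘g : ∀ {ys} → R′ ys → f (g ys) ≡ ys) where

  -- Each inequality is one use of `leftInverse⇒length≤`. The sizes n and n′ may differ because p(n
  -- - e) is computed from the candidates of n - e, whereas counts with a deficiency use those of n.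
  bijection⇒length-filter≡ :
    length (filter R? (candidates n)) ≡ length (filter R′? (candidates n′))
  bijection⇒length-filter≡ = ≤-antisym
    (leftInverse⇒length≤ f g (Unique.filter⁺ R? (candidates-unique n))
      (λ p → let Rx = proj₂ (∈-filter⁻ R? {xs = candidates n} p) in ∈-filter⁺ R′? (R′⊆ (to Rx)) (to Rx))
      (λ p → g∘f (proj₂ (∈-filter⁻ R? {xs = candidates n} p))))
    (leftInverse⇒length≤ g f (Unique.filter⁺ R′? (candidates-unique n′))
      (λ p → let Ry = proj₂ (∈-filter⁻ R′? {xs = candidates n′} p) in ∈-filter⁺ R? (R⊆ (from Ry)) (from Ry))
      (λ p → f∘g (proj₂ (∈-filter⁻ R′? {xs = candidates n′} p))))

Partition⇒∈candidates : ∀ {n e xs} → Partition n e xs → xs ∈ candidates n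
Partition⇒∈candidates {e = e} {xs} (_ , pos , eq) =
  ∈-candidates pos (≤-trans (m≤m+n (sum xs) e) (≤-reflexive eq))

module _ (n e e′ : ℕ) {Q Q′ : Pred (List ℕ) 0ℓ} (Q? : Decidable Q) (Q′? : Decidable Q′) where

  #-bijection : (f g : List ℕ → List ℕ) →
    (∀ {xs} → Partition n e xs → Q xs → Partition n e′ (f xs) × Q′ (f xs) × g (f xs) ≡ xs) →
    (∀ {ys} → Partition n e′ ys → Q′ ys → Partition n e (g ys) × Q (g ys) × f (g ys) ≡ ys) →
    # n e Q? ≡ # n e′ Q′?
  #-bijection f g to from = bijection⇒length-filter≡ {n} {n}
    (λ xs → partition? n e xs ×-dec Q? xs) (λ xs → partition? n e′ xs ×-dec Q′? xs)
    (Partition⇒∈candidates ∘ proj₁) (Partition⇒∈candidates ∘ proj₁) f g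
    (λ (p , q) → let p′ , q′ , _ = to p q in p′ , q′)
    (λ (p , q) → let p′ , q′ , _ = from p q in p′ , q′)
    (λ (p , q) → proj₂ (proj₂ (to p q)))
    (λ (p , q) → proj₂ (proj₂ (from p q)))

module _ (n e : ℕ) {Q Q′ : Pred (List ℕ) 0ℓ} (Q? : Decidable Q) (Q′? : Decidable Q′) where

  #-cong : (∀ {xs} → Partition n e xs → Q xs → Q′ xs) →
           (∀ {xs} → Partition n e xs → Q′ xs → Q xs) → # n e Q? ≡ # n e Q′?
  #-cong to from = #-bijection n e e Q? Q′? id id
    (λ p q → p , to p q , refl) (λ p q → p , from p q , refl)

module _ (n e : ℕ) {Q : Pred (List ℕ) 0ℓ} (Q? : Decidable Q) where

  #-empty : (∀ {xs} → Partition n e xs → ¬ Q xs) → # n e Q? ≡ 0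
  #-empty ¬Q = cong length (List.filter-none (λ xs → partition? n e xs ×-dec Q? xs)
    (All.universal (λ _ (p , q) → ¬Q p q) (candidates n)))

module _ {A : Set} {R R₁ R₂ : Pred A 0ℓ}
  (R? : Decidable R) (R₁? : Decidable R₁) (R₂? : Decidable R₂)
  (R₁⊆R : R₁ ⊆ R) (R₂⊆R : R₂ ⊆ R) (R⊆R₁∪R₂ : R ⊆ R₁ ∪ R₂) (disjoint : ∀ {x} → R₁ x → ¬ R₂ x) where

  length-filter-split : ∀ xs →
    length (filter R? xs) ≡ length (filter R₁? xs) + length (filter R₂? xs)
  length-filter-split []       = refl
  length-filter-split (x ∷ xs) with R? x | R₁? x | R₂? x
  ... | yes _ | yes r₁ | yes r₂ = ⊥-elim (disjoint r₁ r₂)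
  ... | yes _ | yes _  | no _   = cong suc (length-filter-split xs)
  ... | yes _ | no _   | yes _  = trans (cong suc (length-filter-split xs)) (sym (+-suc _ _))
  ... | yes r | no ¬r₁ | no ¬r₂ = ⊥-elim ([ ¬r₁ , ¬r₂ ]′ (R⊆R₁∪R₂ r))
  ... | no ¬r | yes r₁ | _      = ⊥-elim (¬r (R₁⊆R r₁))
  ... | no ¬r | no _   | yes r₂ = ⊥-elim (¬r (R₂⊆R r₂))
  ... | no _  | no _   | no _   = length-filter-split xs

module _ (n e : ℕ) {Q Q₁ Q₂ : Pred (List ℕ) 0ℓ}
  (Q? : Decidable Q) (Q₁? : Decidable Q₁) (Q₂? : Decidable Q₂) where

  #-split : (∀ {xs} → Q₁ xs → Q xs) → (∀ {xs} → Q₂ xs → Q xs) →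
    (∀ {xs} → Q xs → Q₁ xs ⊎ Q₂ xs) → (∀ {xs} → Q₁ xs → ¬ Q₂ xs) →
    # n e Q? ≡ # n e Q₁? + # n e Q₂?
  #-split Q₁⊆Q Q₂⊆Q Q⊆Q₁∪Q₂ disjoint = length-filter-split
    (λ xs → partition? n e xs ×-dec Q? xs)
    (λ xs → partition? n e xs ×-dec Q₁? xs)
    (λ xs → partition? n e xs ×-dec Q₂? xs)
    (λ (p , q) → p , Q₁⊆Q q) (λ (p , q) → p , Q₂⊆Q q)
    (λ (p , q) → Sum.map (p ,_) (p ,_) (Q⊆Q₁∪Q₂ q))
    (λ (_ , q₁) (_ , q₂) → disjoint q₁ q₂) (candidates n)

#-vanishes : ∀ n e {Q : Pred (List ℕ) 0ℓ} (Q? : Decidable Q) → n < e → # n e Q? ≡ 0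
#-vanishes n e Q? n<e = #-empty n e Q?
  (λ {xs} (_ , _ , s) _ → <⇒≱ n<e (≤-trans (m≤n+m e (sum xs)) (≤-reflexive s)))

all? : Decidable {A = List ℕ} (λ _ → ⊤)
all? _ = yes tt

-- The hypothesis e ≤ n keeps the truncated difference exact: for e > n the left side would be p(0)
-- = 1 and the right side 0.
p≡# : ∀ {n e} → e ≤ n → p (n ∸ e) ≡ # n e all?
p≡# {n} {e} e≤n = bijection⇒length-filter≡ {n ∸ e} {n}
  (λ xs → isPartition? (n ∸ e) xs ×-dec all? xs) (λ xs → partition? n e xs ×-dec all? xs)
  (λ ((_ , pos , s) , _) → ∈-candidates pos (≤-reflexive s)) (Partition⇒∈candidates ∘ proj₁) id id
  (λ ((d , pos , s) , _) → (d , pos , trans (cong (λ x → x + e) s) (m∸n+n≡m e≤n)) , tt)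
  (λ {xs} ((d , pos , s) , _) → (d , pos , trans (sym (m+n∸n≡m (sum xs) e)) (cong (_∸ e) s)) , tt)
  (λ _ → refl) (λ _ → refl)

-- Descending lists as multisets

≥-decTotalOrder : DecTotalOrder _ _ _
≥-decTotalOrder = Flip.decTotalOrder ≤-decTotalOrder

open DecTotalOrder ≥-decTotalOrder using () renaming (totalOrder to ≥-totalOrder)

Desc : List ℕ → Set
Desc = Linked _≥_

≥-trans : ∀ {i j k} → i ≥ j → j ≥ k → i ≥ k
≥-trans = flip ≤-trans

desc-head : ∀ {x xs} → Desc (x ∷ xs) → All (_≤ x) xs
desc-head d = AllPairs.head (Linked.Linked⇒AllPairs ≥-trans d)

desc-∷ : ∀ {x xs} → All (_≤ x) xs → Desc xs → Desc (x ∷ xs)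
desc-∷ []      []       = [-]
desc-∷ (p ∷ _) [-]      = p ∷ [-]
desc-∷ (p ∷ _) (q ∷ qs) = p ∷ q ∷ qs

-- A multiset has only one descending arrangement. Inverse laws for insertion, deletion and merging
-- thereby reduce to permutations.
desc-↭⇒≡ : ∀ {xs ys} → Desc xs → Desc ys → xs ↭ ys → xs ≡ ys
desc-↭⇒≡ dx dy p = Pointwise-≡⇒≡ (Sorted.↗↭↗⇒≋ ≥-totalOrder dx dy (↭⇒↭ₛ p))

merge-desc : ∀ {xs ys} → Desc xs → Desc ys → Desc (merge _≥?_ xs ys)
merge-desc = Sorted.merge⁺ ≥-decTotalOrder

insert : ℕ → List ℕ → List ℕ
insert x = merge _≥?_ [ x ]

insert-↭ : ∀ x xs → insert x xs ↭ x ∷ xs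
insert-↭ x xs = merge-↭ _≥?_ [ x ] xs

insert-desc : ∀ x {xs} → Desc xs → Desc (insert x xs)
insert-desc x = merge-desc [-]

delete : ℕ → List ℕ → List ℕ
delete x []       = []
delete x (y ∷ ys) with x ≟ y
... | yes _ = ys
... | no  _ = y ∷ delete x ys

delete-↭ : ∀ {x xs} → x ∈ xs → x ∷ delete x xs ↭ xs
delete-↭ {x} {y ∷ ys} p with x ≟ y | p
... | yes refl | _         = ↭-refl
... | no x≢y   | here x≡y  = ⊥-elim (x≢y x≡y)
... | no x≢y   | there x∈  = ↭-trans (swap x y ↭-refl) (prep y (delete-↭ x∈))

delete-all : ∀ {P : ℕ → Set} x {xs} → All P xs → All P (delete x xs)
delete-all x [] = []
delete-all x {y ∷ ys} (p ∷ ps) with x ≟ y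
... | yes _ = ps
... | no  _ = p ∷ delete-all x ps

delete-desc : ∀ x {xs} → Desc xs → Desc (delete x xs)
delete-desc x {[]} d = []
delete-desc x {y ∷ ys} d with x ≟ y
... | yes _ = Linked.tail d
... | no  _ = desc-∷ (delete-all x (desc-head d)) (delete-desc x (Linked.tail d))

∈-delete : ∀ {x y xs} → y ≢ x → y ∈ xs → y ∈ delete x xs
∈-delete {x} {y} {z ∷ xs} y≢x p with x ≟ z | p
... | yes refl | here y≡x = ⊥-elim (y≢x y≡x)
... | yes refl | there q  = q
... | no _     | here q   = here q
... | no _     | there q  = there (∈-delete y≢x q)

delete-insert : ∀ x {xs} → Desc xs → delete x (insert x xs) ≡ xs
delete-insert x {xs} d = desc-↭⇒≡ (delete-desc x (insert-desc x d)) d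
  (drop-∷ (↭-trans (delete-↭ (∈-resp-↭ (↭-sym (insert-↭ x xs)) (here refl))) (insert-↭ x xs)))

insert-delete : ∀ {x xs} → Desc xs → x ∈ xs → insert x (delete x xs) ≡ xs
insert-delete {x} {xs} d x∈ = desc-↭⇒≡ (insert-desc x (delete-desc x d)) d
  (↭-trans (insert-↭ x (delete x xs)) (delete-↭ x∈))

∈-insert : ∀ x xs → x ∈ insert x xs
∈-insert x xs = ∈-resp-↭ (↭-sym (insert-↭ x xs)) (here refl)

∈-insert-there : ∀ {x xs y} → y ∈ xs → y ∈ insert x xs
∈-insert-there {x} {xs} p = ∈-resp-↭ (↭-sym (insert-↭ x xs)) (there p)

all-insert : ∀ {P : ℕ → Set} {x xs} → P x → All P xs → All P (insert x xs)
all-insert {x = x} {xs} p ps = All-resp-↭ (↭-sym (insert-↭ x xs)) (p ∷ ps)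

-- Shifting the Durfee rectangle on index lists

-- Let t be the first position, counted from 0, with i_t ≤ k + t or i_t missing.
-- Hit k means i_t = k + t, and Off k the opposite.  For k = ν + 1 this t is the
-- height of the (ν+2)-Durfee rectangle, and Off is the second condition of MCond.
data Off : ℕ → List ℕ → Set where
  none : ∀ {k} → Off k []
  stop : ∀ {k i is} → i < k → Off k (i ∷ is)
  step : ∀ {k i is} → k < i → Off (suc k) is → Off k (i ∷ is)

data Hit : ℕ → List ℕ → Set where
  stop : ∀ {k is} → Hit k (k ∷ is)
  step : ∀ {k i is} → k < i → Hit (suc k) is → Hit k (i ∷ is)

off⊎hit : ∀ k is → Off k is ⊎ Hit k is
off⊎hit k []       = inj₁ none
off⊎hit k (i ∷ is) with <-cmp i k
... | tri< i<k _ _  = inj₁ (stop i<k)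
... | tri≈ _ refl _ = inj₂ stop
... | tri> _ _ k<i with off⊎hit (suc k) is
...   | inj₁ o = inj₁ (step k<i o)
...   | inj₂ h = inj₂ (step k<i h)

off⇒¬hit : ∀ {k is} → Off k is → ¬ Hit k is
off⇒¬hit (stop k<k) stop      = <-irrefl refl k<k
off⇒¬hit (stop i<k) (step k<i _) = <-asym i<k k<i
off⇒¬hit (step k<k _) stop      = <-irrefl refl k<k
off⇒¬hit (step _ o) (step _ h) = off⇒¬hit o h

hit? : ∀ k is → Dec (Hit k is)
hit? k is with off⊎hit k is
... | inj₁ o = no (off⇒¬hit o)
... | inj₂ h = yes h

off? : ∀ k is → Dec (Off k is)
off? k is with off⊎hit k is
... | inj₁ o = yes o
... | inj₂ h = no (λ o → off⇒¬hit o h)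

off-≤ : ∀ {k is} → All (_≤ k) is → Off (suc k) is
off-≤ []      = none
off-≤ (p ∷ _) = stop (s≤s p)

desc-all-≤ : ∀ {k i is} → Desc (i ∷ is) → i < suc k → All (_≤ k) (i ∷ is)
desc-all-≤ d (s≤s i≤k) = i≤k ∷ All.map (λ p → ≤-trans p i≤k) (desc-head d)

<-tail : ∀ {j k i is} → j ≤ k → k < i → j ∈ i ∷ is → j ∈ is
<-tail j≤k k<i (here refl) = ⊥-elim (<⇒≱ k<i j≤k)
<-tail j≤k k<i (there p)   = p

-- k grows by one per row passed, so that the row removed by lengthen has index
-- k + t; in the end lengthen and shorten are applied with k = r.
module _ (r : ℕ) where

  lengthen : ℕ → List ℕ → List ℕ
  lengthen k []       = []
  lengthen k (i ∷ is) with k <? i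
  ... | yes _ = suc i ∷ lengthen (suc k) is
  -- Under `Hit k` this branch has i = k: that row is dropped and a row of index r joins the rows
  -- below it.
  ... | no  _ = insert r is

  shorten : ℕ → List ℕ → List ℕ
  shorten k []       = []
  shorten k (i ∷ is) with k <? i
  ... | yes _ = pred i ∷ shorten (suc k) is
  -- The row removed by `lengthen` had index exactly k at this position, so it can be restored
  -- without being remembered.
  ... | no  _ = k ∷ delete r (i ∷ is)

  lengthen-> : ∀ {k i} is → k < i → lengthen k (i ∷ is) ≡ suc i ∷ lengthen (suc k) is
  lengthen-> {k} {i} is k<i with k <? i
  ... | yes _   = refl
  ... | no  k≮i = ⊥-elim (k≮i k<i)

  lengthen-≡ : ∀ k is → lengthen k (k ∷ is) ≡ insert r is
  lengthen-≡ k is with k <? k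
  ... | yes k<k = ⊥-elim (<-irrefl refl k<k)
  ... | no  _   = refl

  shorten-> : ∀ {k i} is → k < i → shorten k (i ∷ is) ≡ pred i ∷ shorten (suc k) is
  shorten-> {k} {i} is k<i with k <? i
  ... | yes _   = refl
  ... | no  k≮i = ⊥-elim (k≮i k<i)

  shorten-≤ : ∀ {k is} → r ∈ is → All (_≤ k) is → shorten k is ≡ k ∷ delete r is
  shorten-≤ {k} {i ∷ is} _ (i≤k ∷ _) with k <? i
  ... | yes k<i = ⊥-elim (<⇒≱ k<i i≤k)
  ... | no  _   = refl

  -- The passed rows lie above k and stay above the threshold, which rises together with them.
  -- Behind the removed row everything is at most k, including the inserted r, so the scan stops
  -- strictly below the new threshold.
  lengthen-off : ∀ {k is} → r ≤ k → Desc is → Hit k is → Off (suc k) (lengthen k is)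
  lengthen-off {k} {_ ∷ is} r≤k d stop rewrite lengthen-≡ k is = off-≤ (all-insert r≤k (desc-head d))
  lengthen-off {is = _ ∷ is} r≤k d (step k<i h) rewrite lengthen-> is k<i =
    step (s≤s k<i) (lengthen-off (m≤n⇒m≤1+n r≤k) (Linked.tail d) h)

  lengthen-all-≤ : ∀ {k b is} → r ≤ suc b → All (_≤ b) is → All (_≤ suc b) (lengthen k is)
  lengthen-all-≤ r≤ [] = []
  lengthen-all-≤ {k} {b} {i ∷ is} r≤ (p ∷ ps) with k <? i
  ... | yes _ = s≤s p ∷ lengthen-all-≤ r≤ ps
  ... | no  _ = all-insert r≤ (All.map m≤n⇒m≤1+n ps)

  lengthen-desc : ∀ {k is} → r ≤ k → Desc is → Desc (lengthen k is)
  lengthen-desc {k} {[]} r≤k d = []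
  lengthen-desc {k} {i ∷ is} r≤k d with k <? i
  ... | yes k<i = desc-∷ (lengthen-all-≤ (m≤n⇒m≤1+n (≤-trans r≤k (<⇒≤ k<i))) (desc-head d))
                         (lengthen-desc (m≤n⇒m≤1+n r≤k) (Linked.tail d))
  ... | no  _   = insert-desc r (Linked.tail d)

  -- Each passed row gains one box while the index of the row to be removed rises by one, so the two
  -- changes cancel. For r = k the sum is preserved.
  lengthen-sum : ∀ {k is} → Hit k is → sum (lengthen k is) + k ≡ sum is + r
  lengthen-sum {k} {_ ∷ is} stop rewrite lengthen-≡ k is | sum-↭ (insert-↭ r is) = begin
    r + sum is + k   ≡⟨ +-comm (r + sum is) k ⟩
    k + (r + sum is) ≡⟨ cong (k +_) (+-comm r (sum is)) ⟩
    k + (sum is + r) ≡⟨ sym (+-assoc k (sum is) r) ⟩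
    k + sum is + r   ∎
    where open ≡-Reasoning
  lengthen-sum {k} {i ∷ is} (step k<i h) rewrite lengthen-> is k<i = begin
    suc (i + sum (lengthen (suc k) is)) + k ≡⟨ cong suc (+-assoc i _ k) ⟩
    suc (i + (sum (lengthen (suc k) is) + k)) ≡⟨ sym (+-suc i _) ⟩
    i + suc (sum (lengthen (suc k) is) + k) ≡⟨ cong (i +_) (sym (+-suc _ k)) ⟩
    i + (sum (lengthen (suc k) is) + suc k) ≡⟨ cong (i +_) (lengthen-sum h) ⟩
    i + (sum is + r)                        ≡⟨ sym (+-assoc i (sum is) r) ⟩
    i + sum is + r                          ∎
    where open ≡-Reasoning

  lengthen-length : ∀ {k is} → Hit k is → length (lengthen k is) ≡ length is
  lengthen-length {k} {_ ∷ is} stop rewrite lengthen-≡ k is = ↭-length (insert-↭ r is)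
  lengthen-length {k} {_ ∷ is} (step k<i h) rewrite lengthen-> is k<i = cong suc (lengthen-length h)

  lengthen-∈ : ∀ {k is} → Hit k is → r ∈ lengthen k is
  lengthen-∈ {k} {_ ∷ is} stop rewrite lengthen-≡ k is = ∈-insert r is
  lengthen-∈ {k} {_ ∷ is} (step k<i h) rewrite lengthen-> is k<i = there (lengthen-∈ h)

  -- Indices below r ≤ k belong neither to the passed rows nor to the removed one.
  lengthen-∈-< : ∀ {k is j} → r ≤ k → Hit k is → j < r → j ∈ is → j ∈ lengthen k is
  lengthen-∈-< r≤k stop j<r (here refl) = ⊥-elim (<⇒≱ j<r r≤k)
  lengthen-∈-< {k} {_ ∷ is} r≤k stop j<r (there j∈) rewrite lengthen-≡ k is = ∈-insert-there j∈
  lengthen-∈-< r≤k (step k<i h) j<r (here refl) = ⊥-elim (<-asym k<i (<-≤-trans j<r r≤k))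
  lengthen-∈-< {k} {_ ∷ is} r≤k (step k<i h) j<r (there j∈) rewrite lengthen-> is k<i =
    there (lengthen-∈-< (m≤n⇒m≤1+n r≤k) h j<r j∈)

  shorten-lengthen : ∀ {k is} → r ≤ k → Desc is → Hit k is → shorten k (lengthen k is) ≡ is
  shorten-lengthen {k} {_ ∷ is} r≤k d stop
    rewrite lengthen-≡ k is | shorten-≤ (∈-insert r is) (all-insert r≤k (desc-head d)) =
    cong (k ∷_) (delete-insert r (Linked.tail d))
  shorten-lengthen {k} {i ∷ is} r≤k d (step k<i h)
    rewrite lengthen-> is k<i | shorten-> (lengthen (suc k) is) (m≤n⇒m≤1+n k<i) =
    cong (i ∷_) (shorten-lengthen (m≤n⇒m≤1+n r≤k) (Linked.tail d) h)

  -- `Off (suc k)` excludes the index `suc k`. A row above k therefore has index at least k + 2 and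
  -- remains above k after losing a box.
  shorten-hit : ∀ {k is} → r ≤ k → Desc is → Off (suc k) is → r ∈ is → Hit k (shorten k is)
  shorten-hit r≤k d (stop i<) r∈ rewrite shorten-≤ r∈ (desc-all-≤ d i<) = stop
  shorten-hit {k} {suc i ∷ is} r≤k d (step (s≤s k<i) o) r∈
    rewrite shorten-> is (m≤n⇒m≤1+n k<i) =
    step k<i (shorten-hit (m≤n⇒m≤1+n r≤k) (Linked.tail d) o (<-tail r≤k (m≤n⇒m≤1+n k<i) r∈))

  -- Needed to place a shortened row of index b before its tail: later rows either lose a box as
  -- well or are bounded by k, and the restored row is k ≤ b.
  shorten-all-≤ : ∀ {k b is} → r ≤ k → Desc is → Off (suc k) is → r ∈ is → k ≤ b →
    All (_≤ suc b) is → All (_≤ b) (shorten k is)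
  shorten-all-≤ r≤k d (stop i<) r∈ k≤b ps rewrite shorten-≤ r∈ (desc-all-≤ d i<) =
    k≤b ∷ delete-all r (All.map (λ p → ≤-trans p k≤b) (desc-all-≤ d i<))
  shorten-all-≤ {is = suc i ∷ is} r≤k d (step (s≤s k<i) o) r∈ k≤b (s≤s p ∷ ps)
    rewrite shorten-> is (m≤n⇒m≤1+n k<i) =
    p ∷ shorten-all-≤ (m≤n⇒m≤1+n r≤k) (Linked.tail d) o (<-tail r≤k (m≤n⇒m≤1+n k<i) r∈) (≤-trans k<i p) ps

  shorten-desc : ∀ {k is} → r ≤ k → Desc is → Off (suc k) is → r ∈ is → Desc (shorten k is)
  shorten-desc r≤k d (stop i<) r∈ rewrite shorten-≤ r∈ (desc-all-≤ d i<) =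
    desc-∷ (delete-all r (desc-all-≤ d i<)) (delete-desc r d)
  shorten-desc {is = suc i ∷ is} r≤k d (step (s≤s k<i) o) r∈
    rewrite shorten-> is (m≤n⇒m≤1+n k<i) =
    desc-∷ (shorten-all-≤ (m≤n⇒m≤1+n r≤k) (Linked.tail d) o r∈′ k<i (desc-head d))
           (shorten-desc (m≤n⇒m≤1+n r≤k) (Linked.tail d) o r∈′)
    where r∈′ = <-tail r≤k (m≤n⇒m≤1+n k<i) r∈

  shorten-∈-< : ∀ {k is j} → r ≤ k → Desc is → Off (suc k) is → r ∈ is →
    j < r → j ∈ is → j ∈ shorten k is
  shorten-∈-< r≤k d (stop i<) r∈ j<r j∈ rewrite shorten-≤ r∈ (desc-all-≤ d i<) =
    there (∈-delete (<⇒≢ j<r) j∈)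
  shorten-∈-< {is = suc i ∷ is} r≤k d (step (s≤s k<i) o) r∈ j<r j∈
    rewrite shorten-> is (m≤n⇒m≤1+n k<i) =
    there (shorten-∈-< (m≤n⇒m≤1+n r≤k) (Linked.tail d) o (<-tail r≤k (m≤n⇒m≤1+n k<i) r∈) j<r
      (<-tail (≤-trans (<⇒≤ j<r) r≤k) (m≤n⇒m≤1+n k<i) j∈))

  lengthen-shorten : ∀ {k is} → r ≤ k → Desc is → Off (suc k) is → r ∈ is →
    lengthen k (shorten k is) ≡ is
  lengthen-shorten {k} {is} r≤k d (stop i<) r∈ rewrite shorten-≤ r∈ (desc-all-≤ d i<) =
    trans (lengthen-≡ k (delete r is)) (insert-delete d r∈)
  lengthen-shorten {k} {is = suc i ∷ is} r≤k d (step (s≤s k<i) o) r∈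
    rewrite shorten-> is (m≤n⇒m≤1+n k<i) =
    trans (lengthen-> (shorten (suc k) is) k<i)
      (cong (suc i ∷_) (lengthen-shorten (m≤n⇒m≤1+n r≤k) (Linked.tail d) o (<-tail r≤k (m≤n⇒m≤1+n k<i) r∈)))

-- The Durfee condition as a scan along the rows

-- `durfeeAux` searches upwards from the last row, whereas `Off` reads from the first. Dropping the
-- first row shifts positions by one, which raising c by one offsets. By c < l the search succeeds
-- at the first row at the latest.
durfeeAux-> : ∀ {c l} ls j → c < l → durfeeAux (l ∷ ls) c (suc j) ≡ suc (durfeeAux ls (suc c) j)
durfeeAux-> {c} {l} ls zero c<l with suc c ≤? l
... | yes _   = refl
... | no  c≮l = ⊥-elim (c≮l c<l)
durfeeAux-> {c} ls (suc j) c<l with suc (suc j) + c ≤? at ls j | suc j + suc c ≤? at ls j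
... | yes _ | yes _ = refl
... | no  _ | no  _ = durfeeAux-> ls j c<l
... | yes p | no ¬q = ⊥-elim (¬q (subst (_≤ at ls j) (cong suc (sym (+-suc j c))) p))
... | no ¬p | yes q = ⊥-elim (¬p (subst (_≤ at ls j) (cong suc (+-suc j c)) q))

at-≤ : ∀ {c ls} j → All (_≤ c) ls → at ls j ≤ c
at-≤ j       []       = z≤n
at-≤ zero    (p ∷ ps) = p
at-≤ (suc j) (p ∷ ps) = at-≤ j ps

durfeeAux-≤ : ∀ {c ls} j → All (_≤ c) ls → durfeeAux ls c j ≡ 0
durfeeAux-≤ zero ps = refl
durfeeAux-≤ {c} {ls} (suc j) ps with suc j + c ≤? at ls j
... | yes p = ⊥-elim (<⇒≱ (s≤s (m≤n+m c j)) (≤-trans p (at-≤ j ps)))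
... | no  _ = durfeeAux-≤ j ps

durfee : ℕ → List ℕ → ℕ
durfee c ls = durfeeAux ls c (length ls)

durfee-> : ∀ {c l} ls → c < l → durfee c (l ∷ ls) ≡ suc (durfee (suc c) ls)
durfee-> ls = durfeeAux-> ls (length ls)

BelowDurfee : ℕ → List ℕ → Set
BelowDurfee c ls = All (_< durfee c ls + c) (drop (durfee c ls) ls)

-- On a descending list the first row below the rectangle is the largest one there, so comparing it
-- alone with t + c decides the condition. Rows are stripped while c < l; otherwise the height is 0.
belowDurfee⇒off : ∀ {c ls} → Desc ls → BelowDurfee c ls → Off c ls
belowDurfee⇒off {c} {[]} d b = none
belowDurfee⇒off {c} {l ∷ ls} d b with c <? l
... | yes c<l rewrite durfee-> ls c<l =
  step c<l (belowDurfee⇒off (Linked.tail d)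
    (subst (λ s → All (_< s) (drop (durfee (suc c) ls) ls)) (sym (+-suc _ c)) b))
... | no  c≮l rewrite durfeeAux-≤ (suc (length ls)) (desc-all-≤ d (s≤s (≮⇒≥ c≮l))) =
  stop (All.head b)

off⇒belowDurfee : ∀ {c ls} → Desc ls → Off c ls → BelowDurfee c ls
off⇒belowDurfee d none = []
off⇒belowDurfee {ls = l ∷ ls} d (stop l<c)
  rewrite durfeeAux-≤ (suc (length ls)) (desc-all-≤ d (m≤n⇒m≤1+n l<c)) =
  l<c ∷ All.map (λ p → ≤-<-trans p l<c) (desc-head d)
off⇒belowDurfee {c} {l ∷ ls} d (step c<l o) rewrite durfee-> ls c<l =
  subst (λ s → All (_< s) (drop (durfee (suc c) ls) ls)) (+-suc _ c) (off⇒belowDurfee (Linked.tail d) o)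

-- Row lengths exceed indices by one, so the threshold ν + 2 on rows is ν + 1 on indices.
off-map-suc⁺ : ∀ {k is} → Off k is → Off (suc k) (map suc is)
off-map-suc⁺ none       = none
off-map-suc⁺ (stop p)   = stop (s≤s p)
off-map-suc⁺ (step p o) = step (s≤s p) (off-map-suc⁺ o)

off-map-suc⁻ : ∀ {k is} → Off (suc k) (map suc is) → Off k is
off-map-suc⁻ {is = []}    none             = none
off-map-suc⁻ {is = _ ∷ _} (stop (s≤s p))   = stop p
off-map-suc⁻ {is = _ ∷ _} (step (s≤s p) o) = step p (off-map-suc⁻ o)

-- Splitting a partition by residue class

filter-++-filter¬-↭ : ∀ {A : Set} {P : A → Set} (P? : ∀ x → Dec (P x)) xs →
  filter P? xs ++ filter (¬? ∘ P?) xs ↭ xs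
filter-++-filter¬-↭ P? []       = ↭-refl
filter-++-filter¬-↭ P? (x ∷ xs) with P? x
... | yes _ = prep x (filter-++-filter¬-↭ P? xs)
... | no  _ = ↭-trans (shift x (filter P? xs) _) (prep x (filter-++-filter¬-↭ P? xs))

module Residue (a m : ℕ) .{{_ : NonZero m}} (0<a : 0 < a) (a<m : a < m) where

  part : ℕ → ℕ
  part i = a + m * i

  index : ℕ → ℕ
  index x = (x ∸ a) / m

  index-part : ∀ i → index (part i) ≡ i
  index-part i = trans (cong (_/ m) (trans (m+n∸m≡n a (m * i)) (*-comm m i))) (m*n/n≡m i m)

  part-cong : ∀ i → part i % m ≡ a % m
  part-cong i = trans (cong (λ s → (a + s) % m) (*-comm m i)) ([m+kn]%n≡m%n a i m)

  -- As a < m, the remainder of x is a itself, and division with remainder writes x as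
  -- `part (x / m)`.
  part-index : ∀ {x} → x % m ≡ a % m → part (index x) ≡ x
  part-index {x} eq = trans (cong (part ∘ index) x≡) (trans (cong part (index-part (x / m))) (sym x≡))
    where
    x≡ : x ≡ part (x / m)
    x≡ = trans (m≡m%n+[m/n]*n x m)
      (cong₂ _+_ (trans eq (m<n⇒m%n≡m a<m)) (*-comm (x / m) m))

  indices : List ℕ → List ℕ
  indices xs = map index (partsCong a m xs)

  parts : List ℕ → List ℕ
  parts = map part

  rest : List ℕ → List ℕ
  rest = partsNotCong a m

  private
    cong? : Decidable (λ x → x % m ≡ a % m)
    cong? x = x % m ≟ a % m

  parts-indices : ∀ xs → parts (indices xs) ≡ partsCong a m xs
  parts-indices xs = go (All.all-filter cong? xs)
    where
    go : ∀ {ys} → All (λ x → x % m ≡ a % m) ys → parts (map index ys) ≡ ys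
    go []       = refl
    go (p ∷ ps) = cong₂ _∷_ (part-index p) (go ps)

  indices-parts : ∀ is → map index (parts is) ≡ is
  indices-parts []       = refl
  indices-parts (i ∷ is) = cong₂ _∷_ (index-part i) (indices-parts is)

  partsCong-desc : ∀ {xs} → Desc xs → Desc (partsCong a m xs)
  partsCong-desc = Linked.filter⁺ cong? ≥-trans

  rest-desc : ∀ {xs} → Desc xs → Desc (rest xs)
  rest-desc = Linked.filter⁺ (¬? ∘ cong?) ≥-trans

  indices-desc : ∀ {xs} → Desc xs → Desc (indices xs)
  indices-desc d = Linked.map⁺ (Linked.map (λ {x} {y} y≤x → /-monoˡ-≤ m (∸-monoˡ-≤ a y≤x)) (partsCong-desc d))

  parts-desc : ∀ {is} → Desc is → Desc (parts is)
  parts-desc d = Linked.map⁺ (Linked.map (λ p → +-monoʳ-≤ a (*-monoʳ-≤ m p)) d)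

  compose : List ℕ → List ℕ → List ℕ
  compose is ns = merge _≥?_ (parts is) ns

  compose-↭ : ∀ is ns → compose is ns ↭ parts is ++ ns
  compose-↭ is ns = merge-↭ _≥?_ (parts is) ns

  compose-indices-rest : ∀ {xs} → Desc xs → compose (indices xs) (rest xs) ≡ xs
  compose-indices-rest {xs} d = desc-↭⇒≡
    (merge-desc (parts-desc (indices-desc d)) (rest-desc d)) d
    (↭-trans (compose-↭ (indices xs) (rest xs))
      (↭-trans (↭-reflexive (cong (_++ rest xs) (parts-indices xs))) (filter-++-filter¬-↭ cong? xs)))

  NonCong : List ℕ → Set
  NonCong = All (λ x → ¬ (x % m ≡ a % m))

  parts-cong : ∀ is → All (λ x → x % m ≡ a % m) (parts is)
  parts-cong is = All.map⁺ (All.universal part-cong is)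

  module _ {is ns : List ℕ} (di : Desc is) (dn : Desc ns) (nc : NonCong ns) where

    compose-desc : Desc (compose is ns)
    compose-desc = merge-desc (parts-desc di) dn

    indices-compose : indices (compose is ns) ≡ is
    indices-compose = trans (cong (map index) eq) (indices-parts is)
      where
      eq : partsCong a m (compose is ns) ≡ parts is
      eq = desc-↭⇒≡ (partsCong-desc compose-desc) (parts-desc di)
        (↭-trans (filter-↭ cong? (compose-↭ is ns))
          (↭-trans (↭-reflexive (trans (List.filter-++ cong? (parts is) ns)
            (cong₂ _++_ (List.filter-all cong? (parts-cong is)) (List.filter-none cong? nc))))
            (++-identityʳ (parts is))))

    rest-compose : rest (compose is ns) ≡ ns
    rest-compose = desc-↭⇒≡ (rest-desc compose-desc) dn
      (↭-trans (filter-↭ (¬? ∘ cong?) (compose-↭ is ns))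
        (↭-reflexive (trans (List.filter-++ (¬? ∘ cong?) (parts is) ns)
          (cong₂ _++_ (List.filter-none (¬? ∘ cong?) (All.map (λ p ¬p → ¬p p) (parts-cong is)))
                      (List.filter-all (¬? ∘ cong?) nc)))))

  sum-parts : ∀ is → sum (parts is) ≡ a * length is + m * sum is
  sum-parts []       = sym (cong₂ _+_ (*-zeroʳ a) (*-zeroʳ m))
  sum-parts (i ∷ is) = trans (cong (part i +_) (sum-parts is)) (lemma a m i (length is) (sum is))
    where
    lemma : ∀ a m i l s → a + m * i + (a * l + m * s) ≡ a * suc l + m * (i + s)
    lemma = solve-∀

  -- The size depends on the indices only through their number and their sum. Hence index maps
  -- preserving both lift to partitions of the same size.
  sum-compose : ∀ is ns → sum (compose is ns) ≡ a * length is + m * sum is + sum ns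
  sum-compose is ns = trans (sum-↭ (compose-↭ is ns))
    (trans (sum-++ (parts is) ns) (cong (_+ sum ns) (sum-parts is)))

  lift : (List ℕ → List ℕ) → List ℕ → List ℕ
  lift θ xs = compose (θ (indices xs)) (rest xs)

  rest-nonCong : ∀ xs → NonCong (rest xs)
  rest-nonCong = All.all-filter (¬? ∘ cong?)

  module _ (θ : List ℕ → List ℕ) {n e : ℕ} {xs : List ℕ} (P : Partition n e xs)
    (dθ : Desc (θ (indices xs))) where

    private d = proj₁ P

    indices-lift : indices (lift θ xs) ≡ θ (indices xs)
    indices-lift = indices-compose dθ (rest-desc d) (rest-nonCong xs)

    lift-inverse : ∀ {ζ} → ζ (θ (indices xs)) ≡ indices xs → lift ζ (lift θ xs) ≡ xs
    lift-inverse {ζ} inv = trans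
      (cong₂ compose (trans (cong ζ indices-lift) inv) (rest-compose dθ (rest-desc d) (rest-nonCong xs)))
      (compose-indices-rest d)

    lift-partition : length (θ (indices xs)) ≡ length (indices xs) →
      sum (θ (indices xs)) ≡ sum (indices xs) → Partition n e (lift θ xs)
    lift-partition len≡ sum≡ =
      compose-desc dθ (rest-desc d) (rest-nonCong xs) ,
      All-resp-↭ (↭-sym (compose-↭ (θ (indices xs)) (rest xs)))
        (All.++⁺ (All.map⁺ (All.universal (λ i → ≤-trans 0<a (m≤m+n a (m * i))) (θ (indices xs))))
                 (All.filter⁺ (¬? ∘ cong?) (proj₁ (proj₂ P)))) ,
      trans (cong (_+ e) sum-lift) (proj₂ (proj₂ P))
      where
      sum-lift : sum (lift θ xs) ≡ sum xs
      sum-lift = trans (sum-compose (θ (indices xs)) (rest xs))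
        (trans (cong₂ (λ l s → a * l + m * s + sum (rest xs)) len≡ sum≡)
          (trans (sym (sum-compose (indices xs) (rest xs))) (cong sum (compose-indices-rest d))))

  -- The recurrence for partitions containing the first k parts

  Present : ℕ → List ℕ → Set
  Present k xs = All (λ j → part j ∈ xs) (upTo k)

  present? : ∀ k → Decidable (Present k)
  present? k xs = All.all? (λ j → part j ∈? xs) (upTo k)

  ∈⇒∈indices : ∀ {j xs} → part j ∈ xs → j ∈ indices xs
  ∈⇒∈indices {j} p = subst (_∈ _) (index-part j) (∈-map⁺ index (∈-filter⁺ cong? p (part-cong j)))

  ∈indices⇒∈ : ∀ {j xs} → j ∈ indices xs → part j ∈ xs
  ∈indices⇒∈ {xs = xs} p with ∈-map⁻ index p
  ... | x , x∈ , refl with ∈-filter⁻ cong? {xs = xs} x∈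
  ...   | x∈xs , x≡a = subst (_∈ xs) (sym (part-index x≡a)) x∈xs

  present⇒ : ∀ {k xs j} → Present k xs → j < k → j ∈ indices xs
  present⇒ p j<k = ∈⇒∈indices (All.lookup p (∈-upTo⁺ j<k))

  ⇒present : ∀ {k xs} → (∀ {j} → j < k → j ∈ indices xs) → Present k xs
  ⇒present f = All.tabulate (λ p → ∈indices⇒∈ (f (∈-upTo⁻ p)))

  PresentOff PresentHit : ℕ → List ℕ → Set
  PresentOff k xs = Present k xs × Off k (indices xs)
  PresentHit k xs = Present k xs × Hit k (indices xs)

  presentOff? : ∀ k → Decidable (PresentOff k)
  presentOff? k xs = present? k xs ×-dec off? k (indices xs)

  presentHit? : ∀ k → Decidable (PresentHit k)
  presentHit? k xs = present? k xs ×-dec hit? k (indices xs)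

  #present-split : ∀ n e k → # n e (present? k) ≡ # n e (presentOff? k) + # n e (presentHit? k)
  #present-split n e k = #-split n e (present? k) (presentOff? k) (presentHit? k)
    proj₁ proj₁ split (λ (_ , o) (_ , h) → off⇒¬hit o h)
    where
    split : ∀ {xs} → Present k xs → PresentOff k xs ⊎ PresentHit k xs
    split {xs} p = Sum.map (p ,_) (p ,_) (off⊎hit k (indices xs))

  -- With r = k the inserted row is the part a + mk, exactly the one that the stronger presence
  -- condition demands in addition.
  #hit≡#off : ∀ n e k → # n e (presentHit? k) ≡ # n e (presentOff? (suc k))
  #hit≡#off n e k = #-bijection n e e (presentHit? k) (presentOff? (suc k))
    (lift (lengthen k k)) (lift (shorten k k)) to from
    where
    to : ∀ {xs} → Partition n e xs → PresentHit k xs →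
      Partition n e (lift (lengthen k k) xs) × PresentOff (suc k) (lift (lengthen k k) xs) ×
      lift (shorten k k) (lift (lengthen k k) xs) ≡ xs
    to {xs} P (pres , hit) =
      lift-partition (lengthen k k) P d′ (lengthen-length k hit) (+-cancelʳ-≡ k _ _ (lengthen-sum k hit)) ,
      (⇒present (λ j< → subst (_ ∈_) (sym eq) (mem j<)) ,
       subst (Off (suc k)) (sym eq) (lengthen-off k ≤-refl d hit)) ,
      lift-inverse (lengthen k k) P d′ {shorten k k} (shorten-lengthen k ≤-refl d hit)
      where
      d = indices-desc (proj₁ P)
      d′ = lengthen-desc k {k} ≤-refl d
      eq = indices-lift (lengthen k k) P d′
      mem : ∀ {j} → j < suc k → j ∈ lengthen k k (indices xs)
      mem {j} (s≤s j≤k) with m≤n⇒m<n∨m≡n j≤k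
      ... | inj₁ j<k  = lengthen-∈-< k ≤-refl hit j<k (present⇒ pres j<k)
      ... | inj₂ refl = lengthen-∈ k hit
    from : ∀ {xs} → Partition n e xs → PresentOff (suc k) xs →
      Partition n e (lift (shorten k k) xs) × PresentHit k (lift (shorten k k) xs) ×
      lift (lengthen k k) (lift (shorten k k) xs) ≡ xs
    from {xs} P (pres , off) =
      lift-partition (shorten k k) P d′
        -- Length and sum of the shortened list are read off from `lengthen`, which takes it back to
        -- the given list.
        (trans (sym (lengthen-length k hit)) (cong length inv))
        (sym (+-cancelʳ-≡ k _ _ (trans (cong ((_+ k) ∘ sum) (sym inv)) (lengthen-sum k hit)))) ,
      (⇒present (λ j< → subst (_ ∈_) (sym eq)
         (shorten-∈-< k ≤-refl d off k∈ j< (present⇒ pres (m≤n⇒m≤1+n j<)))) ,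
       subst (Hit k) (sym eq) hit) ,
      lift-inverse (shorten k k) P d′ {lengthen k k} inv
      where
      d = indices-desc (proj₁ P)
      k∈ : k ∈ indices xs
      k∈ = present⇒ pres ≤-refl
      d′ = shorten-desc k ≤-refl d off k∈
      eq = indices-lift (shorten k k) P d′
      hit = shorten-hit k ≤-refl d off k∈
      inv = lengthen-shorten k ≤-refl d off k∈

  #off-recurrence : ∀ n e k →
    # n e (presentOff? k) + # n e (presentOff? (suc k)) ≡ # n e (present? k)
  #off-recurrence n e k =
    sym (trans (#present-split n e k) (cong (# n e (presentOff? k) +_) (#hit≡#off n e k)))

  -- The counts of the theorem in terms of indices

  rowLengths-indices : ∀ xs → rowLengths a m (partsCong a m xs) ≡ map suc (indices xs)
  rowLengths-indices xs = trans (List.map-cong (λ x → +-comm (index x) 1) (partsCong a m xs))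
    (List.map-∘ (partsCong a m xs))

  -- An equation of types, so that `subst id` carries the condition over. Apart from the row lengths
  -- only the way of writing t + ν + 2 differs.
  belowDurfee-rows : ∀ ν xs → let ls = rowLengths a m (partsCong a m xs) in
    All (_< durfeeHeight ν ls + ν + 2) (drop (durfeeHeight ν ls) ls) ≡
    BelowDurfee (suc (suc ν)) (map suc (indices xs))
  belowDurfee-rows ν xs rewrite rowLengths-indices xs | +-comm ν 2 =
    cong (λ s → All (_< s) (drop t ls)) (trans (+-assoc t ν 2) (cong (t +_) (+-comm ν 2)))
    where
    ls = map suc (indices xs)
    t = durfee (suc (suc ν)) ls

  pν≡#off : ∀ ν n → pν a m ν n ≡ # n 0 (presentOff? (suc ν))
  pν≡#off ν n = bijection⇒length-filter≡ {n} {n}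
    (λ xs → isPartition? n xs ×-dec PCond? a m ν n xs)
    (λ xs → partition? n 0 xs ×-dec presentOff? (suc ν) xs)
    (λ ((_ , pos , s) , _) → ∈-candidates pos (≤-reflexive s))
    (Partition⇒∈candidates ∘ proj₁)
    id id to from (λ _ → refl) (λ _ → refl)
    where
    rows-desc : ∀ {xs} → Desc xs → Desc (map suc (indices xs))
    rows-desc d = Linked.map⁺ (Linked.map s≤s (indices-desc d))

    to : ∀ {xs} → IsPartition n xs × PCond a m ν n xs → Partition n 0 xs × PresentOff (suc ν) xs
    to {xs} ((d , pos , s) , (_ , _ , pres , below)) =
      (d , pos , trans (+-identityʳ (sum xs)) s) ,
      All.map (λ p → proj₁ (∈-filter⁻ cong? {xs = xs} p)) pres ,
      off-map-suc⁻ (belowDurfee⇒off (rows-desc d) (subst id (belowDurfee-rows ν xs) below))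

    from : ∀ {xs} → Partition n 0 xs × PresentOff (suc ν) xs → IsPartition n xs × PCond a m ν n xs
    from {xs} ((d , pos , s) , pres , off) =
      (d , pos , s′) ,
      (partsCong-desc d , All.filter⁺ cong? pos , sum≡) ,
      All.all-filter cong? xs ,
      All.map (λ {j} p → ∈-filter⁺ cong? p (part-cong j)) pres ,
      subst id (sym (belowDurfee-rows ν xs)) (off⇒belowDurfee (rows-desc d) (off-map-suc⁺ off))
      where
      s′ = trans (sym (+-identityʳ (sum xs))) s
      -- The truncated difference is exact, since the congruent parts and the others together sum to
      -- n.
      sum≡ : sum (partsCong a m xs) ≡ n ∸ sum (rest xs)
      sum≡ = trans (sym (m+n∸n≡m (sum (partsCong a m xs)) (sum (rest xs))))
        (cong (_∸ sum (rest xs)) (trans (sym (sum-++ (partsCong a m xs) (rest xs)))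
          (trans (sum-↭ (filter-++-filter¬-↭ cong? xs)) s′)))

  -- Removing the prescribed parts

  -- For m = 3 these are the pentagonal numbers k(3k - 1)/2 when a = 1 and k(3k + 1)/2 when a = 2.
  weight : ℕ → ℕ
  weight zero    = 0
  weight (suc k) = weight k + part k

  part-injective : ∀ {i j} → part i ≡ part j → i ≡ j
  part-injective {i} {j} eq = trans (sym (index-part i)) (trans (cong index eq) (index-part j))

  present-∷ : ∀ {k xs} → Present k xs → part k ∈ xs → Present (suc k) xs
  present-∷ {k} {xs} pres k∈ = All.tabulate (λ p → mem (∈-upTo⁻ p))
    where
    mem : ∀ {j} → j < suc k → part j ∈ xs
    mem (s≤s j≤k) with m≤n⇒m<n∨m≡n j≤k
    ... | inj₁ j<k  = All.lookup pres (∈-upTo⁺ j<k)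
    ... | inj₂ refl = k∈

  -- One copy of the largest prescribed part moves between the partition and the deficiency. The
  -- smaller prescribed parts differ from it and survive the deletion.
  #present-suc : ∀ n e k → # n (part k + e) (present? k) ≡ # n e (present? (suc k))
  #present-suc n e k = #-bijection n (part k + e) e (present? k) (present? (suc k)) (insert (part k)) (delete (part k)) to from
    where
    to : ∀ {xs} → Partition n (part k + e) xs → Present k xs →
      Partition n e (insert (part k) xs) × Present (suc k) (insert (part k) xs) ×
      delete (part k) (insert (part k) xs) ≡ xs
    to {xs} (d , pos , s) pres =
      (insert-desc (part k) d , all-insert (≤-trans 0<a (m≤m+n a (m * k))) pos ,
       trans (cong (_+ e) (sum-↭ (insert-↭ (part k) xs))) (trans (lemma (part k) (sum xs) e) s)) ,
      present-∷ (All.map ∈-insert-there pres) (∈-insert (part k) xs) ,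
      delete-insert (part k) d
      where
      lemma : ∀ x s e → x + s + e ≡ s + (x + e)
      lemma = solve-∀
    from : ∀ {xs} → Partition n e xs → Present (suc k) xs →
      Partition n (part k + e) (delete (part k) xs) × Present k (delete (part k) xs) ×
      insert (part k) (delete (part k) xs) ≡ xs
    from {xs} (d , pos , s) pres =
      (delete-desc (part k) d , delete-all (part k) pos ,
       trans (lemma (part k) (sum (delete (part k) xs)) e) (trans (cong (_+ e) (sum-↭ (delete-↭ k∈))) s)) ,
      All.tabulate (λ p → let j<k = ∈-upTo⁻ p in
        ∈-delete (<⇒≢ j<k ∘ part-injective) (All.lookup pres (∈-upTo⁺ (m≤n⇒m≤1+n j<k)))) ,
      insert-delete d k∈
      where
      k∈ : part k ∈ xs
      k∈ = All.lookup pres (∈-upTo⁺ ≤-refl)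
      lemma : ∀ x s e → s + (x + e) ≡ x + s + e
      lemma = solve-∀

  #present : ∀ n e k → # n e (present? k) ≡ # n (weight k + e) (present? 0)
  #present n e zero    = refl
  #present n e (suc k) = trans (sym (#present-suc n e k))
    (trans (#present n (part k + e) k) (cong (λ w → # n w (present? 0)) (sym (+-assoc (weight k) (part k) e))))

  pν-recurrence : ∀ n ν → pν a m ν n + pν a m (suc ν) n ≡ # n (weight (suc ν)) all?
  pν-recurrence n ν = begin
    pν a m ν n + pν a m (suc ν) n ≡⟨ cong₂ _+_ (pν≡#off ν n) (pν≡#off (suc ν) n) ⟩
    # n 0 (presentOff? (suc ν)) + # n 0 (presentOff? (suc (suc ν))) ≡⟨ #off-recurrence n 0 (suc ν) ⟩
    # n 0 (present? (suc ν)) ≡⟨ #present n 0 (suc ν) ⟩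
    # n (weight (suc ν) + 0) (present? 0) ≡⟨ cong (λ w → # n w (present? 0)) (+-identityʳ (weight (suc ν))) ⟩
    # n (weight (suc ν)) (present? 0) ≡⟨ #-cong n (weight (suc ν)) (present? 0) all? (λ _ _ → tt) (λ _ _ → []) ⟩
    # n (weight (suc ν)) all? ∎
    where open ≡-Reasoning

  k<part : ∀ k → k < part k
  k<part k = +-mono-≤ 0<a (m≤n*m k m)

  k≤weight : ∀ k → k ≤ weight k
  k≤weight zero    = z≤n
  k≤weight (suc k) = ≤-trans (k<part k) (m≤n+m (part k) (weight k))

  -- The prescribed part a + mν exceeds ν and hence n.
  pν-vanishes : ∀ n ν → n < ν → pν a m ν n ≡ 0
  pν-vanishes n ν n<ν = trans (pν≡#off ν n) (#-empty n 0 (presentOff? (suc ν)) absurd)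
    where
    absurd : ∀ {xs} → Partition n 0 xs → ¬ PresentOff (suc ν) xs
    absurd {xs} (_ , _ , s) (pres , _) = <⇒≱ (<-trans n<ν (k<part ν))
      (≤-trans (All.lookup (all≤sum xs) (All.lookup pres (∈-upTo⁺ ≤-refl)))
        (≤-reflexive (trans (sym (+-identityʳ (sum xs))) s)))

  weight-mono : ∀ {j k} → j ≤ k → weight j ≤ weight k
  weight-mono {k = k}     z≤n = z≤n
  weight-mono {j} {suc k} j≤k with m≤n⇒m<n∨m≡n j≤k
  ... | inj₁ (s≤s j≤k′) = ≤-trans (weight-mono j≤k′) (m≤m+n (weight k) (part k))
  ... | inj₂ refl       = ≤-refl

-- Removing and restoring the first column

positives : List ℕ → List ℕ
positives = filter (0 <?_)

positives-none : ∀ {xs} → All (_≤ 0) xs → positives xs ≡ []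
positives-none ps = List.filter-none (0 <?_) (All.map ≤⇒≯ ps)

sum-positives : ∀ xs → sum (positives xs) ≡ sum xs
sum-positives []           = refl
sum-positives (zero ∷ xs)  = sum-positives xs
sum-positives (suc x ∷ xs) = cong (suc x +_) (sum-positives xs)

sum-pred : ∀ {xs} → All (0 <_) xs → sum (map pred xs) + length xs ≡ sum xs
sum-pred [] = refl
sum-pred {suc x ∷ xs} (s≤s z≤n ∷ ps) = trans (lemma x (sum (map pred xs)) (length xs))
  (cong (suc x +_) (sum-pred ps))
  where
  lemma : ∀ x s l → x + s + suc l ≡ suc x + (s + l)
  lemma = solve-∀

sum-map-suc : ∀ xs → sum (map suc xs) ≡ sum xs + length xs
sum-map-suc []       = refl
sum-map-suc (x ∷ xs) = trans (cong (suc x +_) (sum-map-suc xs)) (lemma x (sum xs) (length xs))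
  where
  lemma : ∀ x s l → suc x + (s + l) ≡ x + s + suc l
  lemma = solve-∀

sum-ones : ∀ k → sum (replicate k 1) ≡ k
sum-ones zero    = refl
sum-ones (suc k) = cong suc (sum-ones k)

-- Parts equal to 1 become 0 and are filtered out. In a descending list they stand at the end, so
-- appending as many ones as rows were lost restores them.
map-suc-positives-map-pred : ∀ {xs} → Desc xs → All (0 <_) xs →
  let qs = positives (map pred xs) in
  map suc qs ++ replicate (length xs ∸ length qs) 1 ≡ xs
map-suc-positives-map-pred {[]} d [] = refl
map-suc-positives-map-pred {suc (suc x) ∷ xs} d (_ ∷ ps) =
  cong (suc (suc x) ∷_) (map-suc-positives-map-pred (Linked.tail d) ps)
-- Below a leading 1 every part is 1, so no row of the tail survives.
map-suc-positives-map-pred {suc zero ∷ xs} d (_ ∷ ps)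
  with positives (map pred xs) | positives-none (All.map⁺ {f = pred} (All.map pred-mono-≤ (desc-head d)))
     | map-suc-positives-map-pred (Linked.tail d) ps
... | .[] | refl | ih = cong (1 ∷_) ih

positives-map-pred : ∀ {rs} k → All (0 <_) rs →
  positives (map pred (map suc rs ++ replicate k 1)) ≡ rs
positives-map-pred zero    [] = refl
positives-map-pred (suc k) [] = positives-map-pred k []
positives-map-pred k (s≤s z≤n ∷ ps) = cong (_ ∷_) (positives-map-pred k ps)

-- For h = 0 the whole list is filtered out, and the default 0 of `at` and `drop` on the empty list
-- still give the right values.
positives-∷ : ∀ {h zs} → All (_≤ h) zs →
  at (positives (h ∷ zs)) 0 ≡ h × drop 1 (positives (h ∷ zs)) ≡ positives zs
positives-∷ {zero} {zs} ps rewrite positives-none ps = refl , refl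
positives-∷ {suc h}     ps = refl , refl

all-≤-head : ∀ {xs} → Desc xs → All (_≤ at xs 0) xs
all-≤-head {[]}     d = []
all-≤-head {x ∷ xs} d = ≤-refl ∷ desc-head d

desc-++-ones : ∀ {xs} k → Desc xs → All (0 <_) xs → Desc (xs ++ replicate k 1)
desc-++-ones zero          d [] = []
desc-++-ones (suc zero)    d [] = [-]
desc-++-ones (suc (suc k)) d [] = ≤-refl ∷ desc-++-ones (suc k) d []
desc-++-ones k d (p ∷ ps) = desc-∷ (All.++⁺ (desc-head d) (All.replicate⁺ k p))
                                   (desc-++-ones k (Linked.tail d) ps)

-- The Bressoud-Zeilberger bijection

-- The integer 3j of the Bressoud–Zeilberger bijection is represented as u − v.
module BressoudZeilberger (u v : ℕ) where

  -- Bounds on Dyson's rank λ₁ - t, namely rank ≤ u - v and rank ≥ u - v - 2, written without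
  -- subtraction.
  Rank≤ Rank≥ : List ℕ → Set
  Rank≤ xs = at xs 0 + v ≤ length xs + u
  Rank≥ xs = length xs + u ≤ 2 + (at xs 0 + v)

  rank≤? : Decidable Rank≤
  rank≤? xs = at xs 0 + v ≤? length xs + u

  rank≥? : Decidable Rank≥
  rank≥? xs = length xs + u ≤? 2 + (at xs 0 + v)

  addRow : List ℕ → List ℕ
  addRow xs = positives ((length xs + u ∸ suc v) ∷ map pred xs)

  -- A first row h = t + u - v - 1 reveals the former number of rows t = h + 1 + v - u, and with it
  -- how many ones were lost.
  removeRow : List ℕ → List ℕ
  removeRow ys = map suc (drop 1 ys) ++ replicate (at ys 0 + suc v ∸ u ∸ length (drop 1 ys)) 1

  module _ (n e e′ : ℕ) (balance : u + e′ ≡ suc v + e)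
    -- the empty partition on either side must not be sent to one of size −1
    (nonempty : e ≡ n → v ≤ u → v < u) (nonempty′ : e′ ≡ n → u ≤ 2 + v → u ≤ 1 + v) where

    private
      to : ∀ {xs} → Partition n e xs → Rank≤ xs →
        Partition n e′ (addRow xs) × Rank≥ (addRow xs) × removeRow (addRow xs) ≡ xs
      to {xs} (d , pos , s) rank =
        (Linked.filter⁺ (0 <?_) ≥-trans (desc-∷ bound (Linked.map⁺ (Linked.map pred-mono-≤ d))) ,
         All.all-filter (0 <?_) (h ∷ map pred xs) ,
         trans (cong (_+ e′) (sum-positives (h ∷ map pred xs))) size) ,
        rank≥ ,
        inverse
        where
        -- Makes the truncated difference `h` exact; for a nonempty partition λ₁ ≥ 1 and the rank
        -- bound suffice.
        v<len+u : ∀ {xs} → All (0 <_) xs → sum xs + e ≡ n → Rank≤ xs → suc v ≤ length xs + u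
        v<len+u []      s rank = nonempty s rank
        v<len+u (p ∷ _) s rank = ≤-trans (+-monoˡ-≤ v p) rank

        h = length xs + u ∸ suc v

        h+v : h + suc v ≡ length xs + u
        h+v = m∸n+n≡m (v<len+u pos s rank)

        pred≤h : ∀ {x} → 0 < x × x ≤ at xs 0 → pred x ≤ h
        pred≤h {suc x} (_ , x≤) = m+n≤o⇒m≤o∸n x
          (≤-trans (≤-reflexive (+-suc x v)) (≤-trans (+-monoˡ-≤ v x≤) rank))

        bound : All (_≤ h) (map pred xs)
        bound = All.map⁺ (All.map pred≤h (All.zip (pos , all-≤-head d)))

        -- The column takes away t boxes and the new row has t + u - v - 1, so the size changes by u
        -- - v - 1, as `balance` records.
        size : h + sum (map pred xs) + e′ ≡ n
        size = trans (+-cancelʳ-≡ (suc v) _ _ (begin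
          h + S + e′ + suc v        ≡⟨ lemma₁ h S e′ (suc v) ⟩
          (h + suc v) + (S + e′)    ≡⟨ cong (_+ (S + e′)) h+v ⟩
          length xs + u + (S + e′)  ≡⟨ lemma₂ (length xs) u S e′ ⟩
          S + length xs + (u + e′)  ≡⟨ cong₂ _+_ (sum-pred pos) balance ⟩
          sum xs + (suc v + e)      ≡⟨ lemma₃ (sum xs) (suc v) e ⟩
          sum xs + e + suc v        ∎)) s
          where
          open ≡-Reasoning
          S = sum (map pred xs)
          lemma₁ : ∀ h s e v → h + s + e + v ≡ (h + v) + (s + e)
          lemma₁ = solve-∀
          lemma₂ : ∀ l u s e → l + u + (s + e) ≡ s + l + (u + e)
          lemma₂ = solve-∀
          lemma₃ : ∀ s v e → s + (v + e) ≡ s + e + v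
          lemma₃ = solve-∀

        length≤ : length (addRow xs) ≤ suc (length xs)
        length≤ = ≤-trans (List.length-filter (0 <?_) (h ∷ map pred xs))
          (s≤s (≤-reflexive (List.length-map pred xs)))

        -- At most t + 1 rows stand against a first row of t + u - v - 1 boxes; this is the source
        -- of the 2 in `Rank≥`.
        rank≥ : Rank≥ (addRow xs)
        rank≥ = begin
          length (addRow xs) + u           ≤⟨ +-monoˡ-≤ u length≤ ⟩
          suc (length xs + u)              ≡⟨ cong suc (sym h+v) ⟩
          suc (h + suc v)                  ≡⟨ cong suc (+-suc h v) ⟩
          2 + (h + v)                      ≡⟨ cong (λ x → 2 + (x + v)) (sym (proj₁ (positives-∷ bound))) ⟩
          2 + (at (addRow xs) 0 + v)       ∎
          where open ≤-Reasoning

        inverse : removeRow (addRow xs) ≡ xs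
        inverse = trans
          (cong₂ (λ x qs → map suc qs ++ replicate (x + suc v ∸ u ∸ length qs) 1)
            (proj₁ (positives-∷ bound)) (proj₂ (positives-∷ bound)))
          (trans (cong (λ x → map suc qs ++ replicate (x ∸ length qs) 1)
                   (trans (cong (_∸ u) h+v) (m+n∸n≡m (length xs) u)))
            (map-suc-positives-map-pred d pos))
          where qs = positives (map pred xs)

      from : ∀ {ys} → Partition n e′ ys → Rank≥ ys →
        Partition n e (removeRow ys) × Rank≤ (removeRow ys) × addRow (removeRow ys) ≡ ys
      from {ys} (d , pos , s) rank =
        (desc-++-ones k (Linked.map⁺ (Linked.map s≤s r-desc)) (All.map⁺ (All.universal (λ _ → s≤s z≤n) r)) ,
         All.++⁺ (All.map⁺ (All.universal (λ _ → s≤s z≤n) r)) (All.replicate⁺ k (s≤s z≤n)) ,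
         size) ,
        rank≤ ,
        inverse
        where
        h = at ys 0
        r = drop 1 ys
        k = h + suc v ∸ u ∸ length r

        tail-desc : ∀ {ys} → Desc ys → Desc (drop 1 ys)
        tail-desc {[]}    d = []
        tail-desc {_ ∷ _} d = Linked.tail d

        r-desc : Desc r
        r-desc = tail-desc d

        r-pos : All (0 <_) r
        r-pos = All.drop⁺ 1 pos

        r≤h : All (_≤ h) r
        r≤h = All.drop⁺ 1 (all-≤-head d)

        -- Ensures that h + 1 + v - u is at least the number of rows below the first, so the count
        -- of restored ones is not truncated.
        len≤ : ∀ {ys} → sum ys + e′ ≡ n → Rank≥ ys → length (drop 1 ys) + u ≤ at ys 0 + suc v
        len≤ {[]}     s rank = nonempty′ s rank
        len≤ {y ∷ ys} s rank = ≤-trans (≤-pred rank) (≤-reflexive (sym (+-suc y v)))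

        len+k : length r + k ≡ h + suc v ∸ u
        len+k = m+[n∸m]≡n (m+n≤o⇒m≤o∸n (length r) (len≤ {ys} s rank))

        length-g : length (removeRow ys) ≡ h + suc v ∸ u
        length-g = trans (List.length-++ (map suc r))
          (trans (cong₂ _+_ (List.length-map suc r) (List.length-replicate k)) len+k)

        u≤ : u ≤ h + suc v
        u≤ = ≤-trans (m≤n+m u (length r)) (len≤ {ys} s rank)

        length-g+u : length (removeRow ys) + u ≡ h + suc v
        length-g+u = trans (cong (_+ u) length-g) (m∸n+n≡m u≤)

        sum-ys : ∀ ys → sum ys ≡ at ys 0 + sum (drop 1 ys)
        sum-ys []       = refl
        sum-ys (y ∷ ys) = refl

        sum-g : sum (removeRow ys) ≡ sum r + length (removeRow ys)
        sum-g = begin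
          sum (removeRow ys)                          ≡⟨ sum-++ (map suc r) (replicate k 1) ⟩
          sum (map suc r) + sum (replicate k 1)       ≡⟨ cong₂ _+_ (sum-map-suc r) (sum-ones k) ⟩
          sum r + length r + k                        ≡⟨ +-assoc (sum r) (length r) k ⟩
          sum r + (length r + k)                      ≡⟨ cong (sum r +_) (trans len+k (sym length-g)) ⟩
          sum r + length (removeRow ys)               ∎
          where open ≡-Reasoning

        size : sum (removeRow ys) + e ≡ n
        size = trans (+-cancelʳ-≡ u _ _ (begin
          sum (removeRow ys) + e + u          ≡⟨ cong (λ x → x + e + u) sum-g ⟩
          sum r + l + e + u                   ≡⟨ lemma₁ (sum r) l e u ⟩
          sum r + e + (l + u)                 ≡⟨ cong (sum r + e +_) length-g+u ⟩
          sum r + e + (h + suc v)             ≡⟨ lemma₂ (sum r) e h (suc v) ⟩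
          h + sum r + (suc v + e)             ≡⟨ cong₂ _+_ (sym (sum-ys ys)) (sym balance) ⟩
          sum ys + (u + e′)                   ≡⟨ lemma₃ (sum ys) u e′ ⟩
          sum ys + e′ + u                     ∎)) s
          where
          open ≡-Reasoning
          l = length (removeRow ys)
          lemma₁ : ∀ s l e u → s + l + e + u ≡ s + e + (l + u)
          lemma₁ = solve-∀
          lemma₂ : ∀ s e h v → s + e + (h + v) ≡ h + s + (v + e)
          lemma₂ = solve-∀
          lemma₃ : ∀ s v e → s + (v + e) ≡ s + e + v
          lemma₃ = solve-∀

        rank≤ : Rank≤ (removeRow ys)
        rank≤ = begin
          at (removeRow ys) 0 + v    ≤⟨ +-monoˡ-≤ v (at-≤ 0 (All.++⁺ (All.map⁺ (All.map s≤s r≤h)) (All.replicate⁺ k (s≤s z≤n)))) ⟩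
          suc h + v                  ≡⟨ sym (+-suc h v) ⟩
          h + suc v                  ≡⟨ sym length-g+u ⟩
          length (removeRow ys) + u  ∎
          where open ≤-Reasoning

        positives-at : ∀ {ys zs} → All (0 <_) ys → positives zs ≡ drop 1 ys → positives (at ys 0 ∷ zs) ≡ ys
        -- The default head 0 of an empty list is filtered out again.
        positives-at []            eq = eq
        positives-at (s≤s z≤n ∷ _) eq = cong (_ ∷_) eq

        inverse : addRow (removeRow ys) ≡ ys
        inverse = trans
          (cong (λ x → positives (x ∷ map pred (removeRow ys)))
            (trans (cong (_∸ suc v) length-g+u) (m+n∸n≡m h (suc v))))
          (positives-at pos (positives-map-pred k r-pos))

    #rank≤≡#rank≥ : # n e rank≤? ≡ # n e′ rank≥?
    #rank≤≡#rank≥ = #-bijection n e e′ rank≤? rank≥? addRow removeRow to from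

open BressoudZeilberger

-- Complementary rank conditions

+-shift₃ : ∀ l u → l + (3 + u) ≡ 3 + (l + u)
+-shift₃ = solve-∀

-- Raising u by 3 turns rank ≥ u - v - 2 into rank ≥ u - v + 1, the negation of rank ≤ u - v.
#-split-u : ∀ n e u v → # n e all? ≡ # n e (rank≤? u v) + # n e (rank≥? (3 + u) v)
#-split-u n e u v = #-split n e all? (rank≤? u v) (rank≥? (3 + u) v) _ _
  (λ {xs} _ → split xs) (λ {xs} → disjoint xs)
  where
  split : ∀ xs → Rank≤ u v xs ⊎ Rank≥ (3 + u) v xs
  split xs with rank≤? u v xs
  ... | yes p = inj₁ p
  ... | no ¬p = inj₂ (≤-trans (≤-reflexive (+-shift₃ (length xs) u)) (s≤s (s≤s (≰⇒> ¬p))))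
  disjoint : ∀ xs → Rank≤ u v xs → ¬ Rank≥ (3 + u) v xs
  disjoint xs p q = <⇒≱ (≤-pred (≤-pred (≤-trans (≤-reflexive (sym (+-shift₃ (length xs) u))) q))) p

-- The complement is now rank ≤ u - v - 3 against rank ≥ u - v - 2. Both versions occur because 3j
-- is -v for j ≤ 0 and u for j > 0.
#-split-v : ∀ n e u v → # n e all? ≡ # n e (rank≤? u (3 + v)) + # n e (rank≥? u v)
#-split-v n e u v = #-split n e all? (rank≤? u (3 + v)) (rank≥? u v) _ _
  (λ {xs} _ → split xs) (λ {xs} → disjoint xs)
  where
  split : ∀ xs → Rank≤ u (3 + v) xs ⊎ Rank≥ u v xs
  split xs with rank≤? u (3 + v) xs
  ... | yes p = inj₁ p
  ... | no ¬p = inj₂ (≤-pred (≤-trans (≰⇒> ¬p) (≤-reflexive (+-shift₃ (at xs 0) v))))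
  disjoint : ∀ xs → Rank≤ u (3 + v) xs → ¬ Rank≥ u v xs
  disjoint xs p q = <⇒≱ (≤-trans (≤-reflexive (sym (+-shift₃ (at xs 0) v))) p) q

-- Equality of the two families of counts

-- Equality holds far out, where both sequences vanish, and the common recurrence carries it
-- downwards. The argument `d` of `go` bounds the number of steps needed to get beyond b.
recurrence-unique : ∀ (X Y : ℕ → ℕ) b → (∀ k → X k + X (suc k) ≡ Y k + Y (suc k)) →
  (∀ k → b < k → X k ≡ 0) → (∀ k → b < k → Y k ≡ 0) → ∀ k → X k ≡ Y k
recurrence-unique X Y b rec X≡0 Y≡0 k = go (suc b) k (m≤m+n (suc b) k)
  where
  go : ∀ d k → b < d + k → X k ≡ Y k
  go zero    k b<k = trans (X≡0 k b<k) (sym (Y≡0 k b<k))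
  go (suc d) k b<  = +-cancelʳ-≡ (X (suc k)) (X k) (Y k)
    (trans (rec k) (cong (λ x → Y k + x) (sym (go d (suc k) (subst (b <_) (sym (+-suc d k)) b<)))))

module R₁ = Residue 1 3 z<s (s<s z<s)
module R₂ = Residue 2 3 z<s (s<s (s<s z<s))

open R₁ using () renaming (weight to w₁)
open R₂ using () renaming (weight to w₂)

module _ (n : ℕ) (0<n : 0 < n) where

  -- A₁ k is A_{−k} and A₂ k is A_{k+1} in the notation of the header.
  A₁ A₂ : ℕ → ℕ
  A₁ k = # n (w₁ k) (rank≤? 0 (k * 3))
  A₂ k = # n (w₂ (suc k)) (rank≤? (suc k * 3) 0)

  A₁-shift : ∀ k → A₁ k ≡ # n (w₁ (suc k)) (rank≥? 0 (k * 3))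
  A₁-shift k = #rank≤≡#rank≥ 0 (k * 3) n (w₁ k) (w₁ (suc k)) (balance (w₁ k) k) (nonempty k) (λ _ _ → z≤n)
    where
    balance : ∀ w k → w + (1 + 3 * k) ≡ suc (k * 3) + w
    balance = solve-∀
    nonempty : ∀ k → w₁ k ≡ n → k * 3 ≤ 0 → k * 3 < 0
    -- Only k = 0 satisfies v ≤ u. There the deficiency is 0, and n > 0 excludes the empty
    -- partition.
    nonempty zero 0≡n _ = ⊥-elim (<⇒≢ 0<n 0≡n)

  A₂-shift : ∀ k → A₂ k ≡ # n (w₂ k) (rank≥? (suc k * 3) 0)
  A₂-shift k = #rank≤≡#rank≥ (suc k * 3) 0 n (w₂ (suc k)) (w₂ k) (balance (w₂ k) k)
    -- Here v = 0 < u settles the first side condition, and u ≥ 3 contradicts the premise u ≤ 2 of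
    -- the second.
    (λ _ _ → s≤s z≤n) (λ _ → λ { (s≤s (s≤s ())) })
    where
    balance : ∀ w k → suc k * 3 + w ≡ 1 + (w + (2 + 3 * k))
    balance = solve-∀

  -- The bijection brings `A₁ k` to the deficiency of `A₁ (suc k)`, where the two rank conditions
  -- are complementary.
  A₁-recurrence : ∀ k → A₁ k + A₁ (suc k) ≡ # n (w₁ (suc k)) all?
  A₁-recurrence k = trans (+-comm (A₁ k) (A₁ (suc k)))
    (trans (cong (λ x → A₁ (suc k) + x) (A₁-shift k)) (sym (#-split-v n (w₁ (suc k)) 0 (k * 3))))

  A₂-recurrence : ∀ k → A₂ k + A₂ (suc k) ≡ # n (w₂ (suc k)) all?
  A₂-recurrence k = trans (cong (λ x → A₂ k + x) (A₂-shift (suc k))) (sym (#-split-u n (w₂ (suc k)) (suc k * 3) 0))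

  -- The case j = 0 of A_j + A_{j+1}, which joins the two families at deficiency 0.
  A₁+A₂ : A₁ 0 + A₂ 0 ≡ # n 0 all?
  A₁+A₂ = trans (cong (λ x → A₁ 0 + x) (A₂-shift 0)) (sym (#-split-u n 0 0 0))

  A₁≡pν : ∀ ν → A₁ ν ≡ pν 1 3 ν n
  A₁≡pν = recurrence-unique A₁ (λ ν → pν 1 3 ν n) n
    (λ k → trans (A₁-recurrence k) (sym (R₁.pν-recurrence n k)))
    (λ k n<k → #-vanishes n (w₁ k) (rank≤? 0 (k * 3)) (<-≤-trans n<k (R₁.k≤weight k)))
    (R₁.pν-vanishes n)

  A₂≡pν : ∀ ν → A₂ ν ≡ pν 2 3 ν n
  A₂≡pν = recurrence-unique A₂ (λ ν → pν 2 3 ν n) n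
    (λ k → trans (A₂-recurrence k) (sym (R₂.pν-recurrence n k)))
    (λ k n<k → #-vanishes n (w₂ (suc k)) (rank≤? (suc k * 3) 0) (<-≤-trans n<k (≤-trans (n≤1+n k) (R₂.k≤weight (suc k)))))
    (R₂.pν-vanishes n)

-- The telescoping alternating sum

open import Data.Integer using (ℤ; +_; -1ℤ; 1ℤ; _^_; _-_) renaming (_*_ to _*ℤ_; _+_ to _+ℤ_)

-1^k*-1^k≡1 : ∀ k → (-1ℤ ^ k) *ℤ (-1ℤ ^ k) ≡ 1ℤ
-1^k*-1^k≡1 zero    = refl
-1^k*-1^k≡1 (suc k) = trans (lemma (-1ℤ ^ k)) (-1^k*-1^k≡1 k)
  where
  lemma : ∀ s → (-1ℤ *ℤ s) *ℤ (-1ℤ *ℤ s) ≡ s *ℤ s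
  lemma = ℤSolver.solve-∀

sumTo-cong : ∀ k {f g : ℕ → ℤ} → (∀ {j} → j ≤ k → f j ≡ g j) → sumTo k f ≡ sumTo k g
sumTo-cong zero    eq = eq z≤n
sumTo-cong (suc k) eq = cong₂ _+ℤ_ (sumTo-cong k (λ j≤k → eq (m≤n⇒m≤1+n j≤k))) (eq ≤-refl)

module _ (P₁ P₂ X₁ X₂ : ℕ → ℕ) (base : X₁ 0 + X₂ 0 ≡ P₂ 0)
  (rec₁ : ∀ k → X₁ k + X₁ (suc k) ≡ P₁ (suc k)) (rec₂ : ∀ k → X₂ k + X₂ (suc k) ≡ P₂ (suc k)) where

  -- Consecutive terms of a family share one summand, so only the far ends of the two families
  -- remain. The near ends cancel against `P₂ 0`, which enters through `base` in the case k = 0.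
  alternating-sum : ∀ k →
    (-1ℤ ^ suc k) *ℤ
      (sumTo (suc k) (λ τ → (-1ℤ ^ τ) *ℤ (+ P₂ τ)) - sumTo k (λ τ → (-1ℤ ^ τ) *ℤ (+ P₁ (suc τ))))
    ≡ + (X₂ (suc k) + X₁ (suc k))
  alternating-sum zero
    rewrite sym base | sym (rec₁ 0) | sym (rec₂ 0)
    = lemma (+ X₁ 0) (+ X₂ 0) (+ X₁ 1) (+ X₂ 1)
    where
    lemma : ∀ x₁ x₂ y₁ y₂ →
      (-1ℤ *ℤ 1ℤ) *ℤ ((1ℤ *ℤ (x₁ +ℤ x₂) +ℤ (-1ℤ *ℤ 1ℤ) *ℤ (x₂ +ℤ y₂)) - 1ℤ *ℤ (x₁ +ℤ y₁)) ≡ y₂ +ℤ y₁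
    lemma = ℤSolver.solve-∀
  alternating-sum (suc k)
    rewrite sym (rec₁ (suc k)) | sym (rec₂ (suc k)) = begin
      (-1ℤ *ℤ s) *ℤ ((S +ℤ (-1ℤ *ℤ s) *ℤ (x₂ +ℤ y₂)) - (T +ℤ s *ℤ (x₁ +ℤ y₁)))
        -- The new terms receive the coefficient s · s = 1. The old bracket reappears with the
        -- factor s of the induction hypothesis and the opposite sign.
        ≡⟨ lemma₁ s S T (x₂ +ℤ y₂) (x₁ +ℤ y₁) ⟩
      (s *ℤ s) *ℤ ((x₂ +ℤ y₂) +ℤ (x₁ +ℤ y₁)) - s *ℤ (S - T)
        ≡⟨ cong₂ (λ c d → c *ℤ ((x₂ +ℤ y₂) +ℤ (x₁ +ℤ y₁)) - d) (-1^k*-1^k≡1 (suc k)) (alternating-sum k) ⟩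
      1ℤ *ℤ ((x₂ +ℤ y₂) +ℤ (x₁ +ℤ y₁)) - (x₂ +ℤ x₁)
        ≡⟨ lemma₂ x₁ x₂ y₁ y₂ ⟩
      y₂ +ℤ y₁ ∎
    where
    open ≡-Reasoning
    s = -1ℤ ^ suc k
    S = sumTo (suc k) (λ τ → (-1ℤ ^ τ) *ℤ (+ P₂ τ))
    T = sumTo k (λ τ → (-1ℤ ^ τ) *ℤ (+ P₁ (suc τ)))
    x₁ = + X₁ (suc k)
    x₂ = + X₂ (suc k)
    y₁ = + X₁ (suc (suc k))
    y₂ = + X₂ (suc (suc k))
    lemma₁ : ∀ s S T p₂ p₁ → (-1ℤ *ℤ s) *ℤ ((S +ℤ (-1ℤ *ℤ s) *ℤ p₂) - (T +ℤ s *ℤ p₁)) ≡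
      (s *ℤ s) *ℤ (p₂ +ℤ p₁) - s *ℤ (S - T)
    lemma₁ = ℤSolver.solve-∀
    lemma₂ : ∀ x₁ x₂ y₁ y₂ → 1ℤ *ℤ ((x₂ +ℤ y₂) +ℤ (x₁ +ℤ y₁)) - (x₂ +ℤ x₁) ≡ y₂ +ℤ y₁
    lemma₂ = ℤSolver.solve-∀

-- Pentagonal numbers and the final assembly

half : ∀ {x y} → y * 2 ≡ x → x / 2 ≡ y
half {y = y} refl = m*n/n≡m y 2

-- The induction runs on the doubled value, where no division occurs.
w₂≡ : ∀ k → k * (3 * k + 1) / 2 ≡ w₂ k
w₂≡ k = half (twice k)
  where
  lemma : ∀ w k → (w + (2 + 3 * k)) * 2 ≡ w * 2 + (4 + 6 * k)
  lemma = solve-∀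
  lemma′ : ∀ k → k * (3 * k + 1) + (4 + 6 * k) ≡ suc k * (3 * suc k + 1)
  lemma′ = solve-∀
  twice : ∀ k → w₂ k * 2 ≡ k * (3 * k + 1)
  twice zero    = refl
  twice (suc k) = trans (lemma (w₂ k) k) (trans (cong (λ x → x + (4 + 6 * k)) (twice k)) (lemma′ k))

-- The weight `w₁ (suc k)` splits as 1 + (`w₁ k` + 3k), and the bracket has the double k(3k + 5).
-- The 1 is the extra shift in the second sum.
w₁≡ : ∀ k → suc (k * (3 * k + 5) / 2) ≡ w₁ (suc k)
w₁≡ k = trans (cong suc (half (twice k))) (sym (+-suc (w₁ k) (3 * k)))
  where
  lemma : ∀ w k → (w + (1 + 3 * k) + 3 * suc k) * 2 ≡ (w + 3 * k) * 2 + (8 + 6 * k)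
  lemma = solve-∀
  lemma′ : ∀ k → k * (3 * k + 5) + (8 + 6 * k) ≡ suc k * (3 * suc k + 5)
  lemma′ = solve-∀
  twice : ∀ k → (w₁ k + 3 * k) * 2 ≡ k * (3 * k + 5)
  twice zero    = refl
  twice (suc k) = trans (lemma (w₁ k) k) (trans (cong (λ x → x + (8 + 6 * k)) (twice k)) (lemma′ k))

-- Lets the single bound on n cover the terms of both sums. Summands compare as 2 + 3k ≤ 1 + 3(k +
-- 1).
w₂≤w₁ : ∀ k → w₂ k ≤ w₁ (suc k)
w₂≤w₁ zero    = z≤n
w₂≤w₁ (suc k) = +-mono-≤ (w₂≤w₁ k) (s≤s (≤-trans (m≤n+m (suc (3 * k)) 2) (≤-reflexive (lemma k))))
  where
  lemma : ∀ k → 2 + suc (3 * k) ≡ 3 * suc k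
  lemma = solve-∀

theorem1p3 : (ν n : ℕ) → 1 ≤ ν → ν * (3 * ν + 5) / 2 < n →
    (-1ℤ ^ ν) *ℤ
    ( sumTo ν (λ τ → (-1ℤ ^ τ) *ℤ (+ p (n ∸ τ * (3 * τ + 1) / 2)))
    - sumTo (ν ∸ 1) (λ τ → (-1ℤ ^ τ) *ℤ (+ p (n ∸ τ * (3 * τ + 5) / 2 ∸ 1))) )
    ≡ + (pν 2 3 ν n + pν 1 3 ν n)
-- Matching on ν makes `ν ∸ 1` reduce to k.
theorem1p3 ν@(suc k) n _ bound = begin
  (-1ℤ ^ ν) *ℤ
    ( sumTo ν (λ τ → (-1ℤ ^ τ) *ℤ (+ p (n ∸ τ * (3 * τ + 1) / 2)))
    - sumTo k (λ τ → (-1ℤ ^ τ) *ℤ (+ p (n ∸ τ * (3 * τ + 5) / 2 ∸ 1))) )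
    ≡⟨ cong₂ (λ S T → (-1ℤ ^ ν) *ℤ (S - T))
         (sumTo-cong ν (λ {τ} τ≤ν → cong (λ x → (-1ℤ ^ τ) *ℤ (+ x)) (term₂ τ≤ν)))
         (sumTo-cong k (λ {τ} τ≤k → cong (λ x → (-1ℤ ^ τ) *ℤ (+ x)) (term₁ τ≤k))) ⟩
  (-1ℤ ^ ν) *ℤ
    ( sumTo ν (λ τ → (-1ℤ ^ τ) *ℤ (+ # n (w₂ τ) all?))
    - sumTo k (λ τ → (-1ℤ ^ τ) *ℤ (+ # n (w₁ (suc τ)) all?)) )
    ≡⟨ alternating-sum (λ τ → # n (w₁ τ) all?) (λ τ → # n (w₂ τ) all?) (A₁ n 0<n) (A₂ n 0<n)
         (A₁+A₂ n 0<n) (A₁-recurrence n 0<n) (A₂-recurrence n 0<n) k ⟩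
  + (A₂ n 0<n ν + A₁ n 0<n ν)
    ≡⟨ cong₂ (λ x y → + (x + y)) (A₂≡pν n 0<n ν) (A₁≡pν n 0<n ν) ⟩
  + (pν 2 3 ν n + pν 1 3 ν n) ∎
  where
  open ≡-Reasoning
  0<n : 0 < n
  0<n = ≤-trans (s≤s z≤n) bound
  -- The strict inequality supplies the missing 1: ν(3ν + 5)/2 < n says exactly that `w₁ (suc ν)` is
  -- at most n.
  w₁≤n : w₁ (suc ν) ≤ n
  w₁≤n = subst (_≤ n) (w₁≡ ν) bound
  term₂ : ∀ {τ} → τ ≤ ν → p (n ∸ τ * (3 * τ + 1) / 2) ≡ # n (w₂ τ) all?
  term₂ {τ} τ≤ν = trans (cong (λ x → p (n ∸ x)) (w₂≡ τ))
    (p≡# (≤-trans (R₂.weight-mono τ≤ν) (≤-trans (w₂≤w₁ ν) w₁≤n)))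
  term₁ : ∀ {τ} → τ ≤ k → p (n ∸ τ * (3 * τ + 5) / 2 ∸ 1) ≡ # n (w₁ (suc τ)) all?
  term₁ {τ} τ≤k = trans (cong p (trans (∸-+-assoc n (τ * (3 * τ + 5) / 2) 1)
      (cong (n ∸_) (trans (+-comm (τ * (3 * τ + 5) / 2) 1) (w₁≡ τ)))))
    (p≡# (≤-trans (R₁.weight-mono (s≤s (m≤n⇒m≤1+n τ≤k))) w₁≤n))
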